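{- Let $d\geq 2$ and let $n_1\geq n_2\geq\cdots\geq n_d\geq 2$ be integers, and let $G=\textsc{Grid}(n_1,\ldots,n_d)$. Then $G$ admits a $Q_d$-magic vertex labeling $f$ and a $Q_d$-magic edge labeling $g$.
   Context: For integers $k\le \ell$, $[k]=\{1,\ldots,k\}$. The grid graph $\textsc{Grid}(n_1,\ldots,n_d)$ has vertex set $V=[n_1]\times\cdots\times[n_d]$ and edge set $E=\{\{\mathbf x,\mathbf y\}: \mathbf x,\mathbf y\in V,\ \sum_{i=1}^d|x_i-y_i|=1\}$ (the Cartesian product of $d$ paths with $n_1,\ldots,n_d$ vertices). The $d$-cube $Q_d$ is $\textsc{Grid}(2,\ldots,2)$ ($d$ entries). For graphs $G=(V,E)$ and $H$: a bijection $f:V\to\{1,\ldots,|V|\}$ is an $H$-magic vertex labeling if there is a constant $c$ with $\sum_{v\in V(H')}f(v)=c$ for every subgraph $H'\subseteq G$ isomorphic to $H$; a bijection $g:E\to\{1,\ldots,|E|\}$ is an $H$-magic edge labeling if there is a constant $c'$ with $\sum_{e\in E(H')}g(e)=c'$ for every subgraph $H'\subseteq G$ isomorphic to $H$. The constants $c$, $c'$ are called the $H$-magic sums. -}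

module Defs where

open import Data.Fin using (Fin; toℕ)
open import Data.List using (List; length; lookup; map; sum)
open import Data.List.Membership.Propositional using (_∈_)
import Data.List.Relation.Unary.All as ListAll
open import Data.List.Relation.Unary.Any as Any using (Any; satisfied)
open import Data.List.Relation.Unary.Unique.Propositional using (Unique)
import Data.List.Relation.Unary.Unique.Setoid as UniqueSetoid
open import Data.Nat using (ℕ; suc; _+_; ∣_-_∣)
open import Data.Nat.Properties using (∣-∣-comm; ∣n-n∣≡0)
open import Data.Product using (∃; _×_; _,_)
open import Data.Sum using (_⊎_; inj₁; inj₂; [_,_]′)
import Data.Sum as Sum
open import Data.Vec using (Vec; []; _∷_; replicate)
open import Data.Vec.Relation.Unary.All using (All; []; _∷_)
open import Function.Base using (id)
open import Function.Bundles using (Bijection; _⇔_; _↔_; Inverse)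
open import Level using (0ℓ)
open import Relation.Binary.Bundles using (Setoid)
open import Relation.Binary.PropositionalEquality
  using (_≡_; refl; sym; trans; cong₂; setoid)
open import Relation.Nullary using (¬_)

record Graph : Set₁ where
  infix 4 _∼_
  field
    Vertex   : Set
    _∼_      : Vertex → Vertex → Set
    ∼-sym    : ∀ {x y} → x ∼ y → y ∼ x
    ∼-irrefl : ∀ {x} → ¬ (x ∼ x)

  -- An edge carries an orientation, which _≈ₑ_ forgets: up to _≈ₑ_ an
  -- edge is the unordered pair of its ends.
  record Edge : Set where
    constructor edge
    field
      src tgt : Vertex
      adj     : src ∼ tgt

  open Edge public

  Joins : Vertex → Vertex → Edge → Set
  Joins x y e = (src e ≡ x × tgt e ≡ y) ⊎ (src e ≡ y × tgt e ≡ x)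

  infix 4 _≈ₑ_
  _≈ₑ_ : Edge → Edge → Set
  e ≈ₑ e′ = Joins (src e′) (tgt e′) e

  vertexSetoid : Setoid 0ℓ 0ℓ
  vertexSetoid = setoid Vertex

  edgeSetoid : Setoid 0ℓ 0ℓ
  edgeSetoid = record
    { Carrier       = Edge
    ; _≈_           = _≈ₑ_
    ; isEquivalence = record
      { refl  = inj₁ (refl , refl)
      ; sym   = λ where
          (inj₁ (p , q)) → inj₁ (sym p , sym q)
          (inj₂ (p , q)) → inj₂ (sym q , sym p)
      ; trans = λ where
          (inj₁ (p , q)) (inj₁ (r , s)) → inj₁ (trans p r , trans q s)
          (inj₁ (p , q)) (inj₂ (r , s)) → inj₂ (trans p r , trans q s)
          (inj₂ (p , q)) (inj₁ (r , s)) → inj₂ (trans p s , trans q r)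
          (inj₂ (p , q)) (inj₂ (r , s)) → inj₁ (trans p s , trans q r)
      }
    }

open Graph using (Vertex; Edge; vertexSetoid; edgeSetoid)

infix 4 _≅_

record _≅_ (G H : Graph) : Set where
  private
    module G = Graph G
    module H = Graph H
  field
    vertices↔ : Vertex G ↔ Vertex H

  open Inverse vertices↔ public using (to; from)

  field
    preserves-∼ : ∀ {x y} → (x G.∼ y) ⇔ (to x H.∼ to y)

-- A finite set of vertices, and a finite set of edges having both ends
-- among those vertices. Finite sets are repetition-free lists, so that
-- sums over them are sums over lists.
record Subgraph (G : Graph) : Set where
  private module G = Graph G
  field
    vertices        : List (Vertex G)
    vertices-unique : Unique vertices
    edges           : List (Edge G)
    edges-unique    : UniqueSetoid.Unique (edgeSetoid G) edges
    ends∈vertices   : ListAll.All (λ e → G.src e ∈ vertices × G.tgt e ∈ vertices) edges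

  -- The vertices are positions in the list `vertices`, which by
  -- uniqueness correspond one-to-one to the vertices occurring in it.
  graph : Graph
  graph = record
    { Vertex   = Fin (length vertices)
    ; _∼_      = λ i j → Any (G.Joins (lookup vertices i) (lookup vertices j)) edges
    ; ∼-sym    = Any.map Sum.swap
    ; ∼-irrefl = λ i∼i → let e , j = satisfied i∼i in loopless e ([ id , id ]′ j)
    }
    where
    loopless : ∀ {v} (e : Edge G) → ¬ (G.src e ≡ v × G.tgt e ≡ v)
    loopless (G.edge _ _ a) (refl , refl) = G.∼-irrefl a

open Subgraph using (vertices; edges; graph)

-- A bijection from S to {1,…,N}, where the label k + 1 is represented
-- by k : Fin N. Bijectivity forces N to be the cardinality of S.
record Labeling (S : Setoid 0ℓ 0ℓ) : Set where
  field
    size      : ℕ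
    bijection : Bijection S (setoid (Fin size))

  label : Setoid.Carrier S → ℕ
  label x = suc (toℕ (Bijection.to bijection x))

open Labeling using (label)

VertexLabeling EdgeLabeling : Graph → Set
VertexLabeling G = Labeling (vertexSetoid G)
EdgeLabeling   G = Labeling (edgeSetoid G)

VertexMagic : (H G : Graph) → VertexLabeling G → Set
VertexMagic H G f =
  ∃ λ c → (H′ : Subgraph G) → graph H′ ≅ H → sum (map (label f) (vertices H′)) ≡ c

EdgeMagic : (H G : Graph) → EdgeLabeling G → Set
EdgeMagic H G g =
  ∃ λ c → (H′ : Subgraph G) → graph H′ ≅ H → sum (map (label g) (edges H′)) ≡ c

-- All Fin (n₁ ∷ … ∷ n_d ∷ []) is the product Fin n₁ × … × Fin n_d.
-- Coordinates run from 0 to nᵢ - 1 instead of from 1 to nᵢ, which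
-- leaves all coordinate differences unchanged.
dist : ∀ {d} {ns : Vec ℕ d} → All Fin ns → All Fin ns → ℕ
dist []       []       = 0
dist (x ∷ xs) (y ∷ ys) = ∣ toℕ x - toℕ y ∣ + dist xs ys

dist-comm : ∀ {d} {ns : Vec ℕ d} (xs ys : All Fin ns) → dist xs ys ≡ dist ys xs
dist-comm []       []       = refl
dist-comm (x ∷ xs) (y ∷ ys) = cong₂ _+_ (∣-∣-comm (toℕ x) (toℕ y)) (dist-comm xs ys)

dist-refl : ∀ {d} {ns : Vec ℕ d} (xs : All Fin ns) → dist xs xs ≡ 0
dist-refl []       = refl
dist-refl (x ∷ xs) = cong₂ _+_ (∣n-n∣≡0 (toℕ x)) (dist-refl xs)

Grid : ∀ {d} → Vec ℕ d → Graph
Grid ns = record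
  { Vertex   = All Fin ns
  ; _∼_      = λ xs ys → dist xs ys ≡ 1
  ; ∼-sym    = λ {xs} {ys} p → trans (dist-comm ys xs) p
  ; ∼-irrefl = λ {xs} p → 0≢1 (trans (sym (dist-refl xs)) p)
  }
  where
  0≢1 : ¬ (0 ≡ 1)
  0≢1 ()

Q : ℕ → Graph
Q d = Grid (replicate d 2)

{-# OPTIONS --safe #-}

-- A subgraph of the grid isomorphic to Q_d is a unit cube: two neighbours
-- u ± eᵢ of u on the same axis have no common neighbour besides u, so the d
-- neighbours of each vertex lie on distinct axes, hence one on each axis.
-- Moving along axis i thus is a fixed-point free involution τ i of the
-- vertices, and sums over the cube are evaluated by pairing along τ.
--
-- Vertices are labelled in mixed radix, where a digit xᵢ is replaced by its
-- mirror image when another coordinate is odd. The mirror image preserves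
-- parity, so this is a bijection, and the four values taken by a digit under
-- τ i and the τ of the other coordinate add up to 2nᵢ - 2. For d ≥ 3 each
-- class of parallel edges is labelled likewise, the lower end's coordinate
-- along the edge being reflected too. For d = 2 an edge has too few transverse
-- coordinates for this; there the rows of horizontal and of vertical edges
-- interleave, with labels of horizontal edges increasing and of vertical ones
-- decreasing, so that in every square the two contributions balance.
module Submission where

open import Data.Empty using (⊥; ⊥-elim)
open import Data.Fin
  using (Fin; zero; suc; toℕ; fromℕ<; inject₁; opposite; combine; remQuot; _↑ˡ_; _↑ʳ_; punchOut)
open import Data.Fin.Permutation using (Permutation; permutation; ↔⇒≡)
open import Data.Fin.Properties
  using ( _≟_; any?; toℕ-injective; toℕ<n; toℕ-fromℕ<; toℕ-inject₁; toℕ-↑ˡ; toℕ-↑ʳ; toℕ-combine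
        ; remQuot-combine; opposite-prop; opposite-involutive; punchOut-injective; <⇒notInjective
        ; +↔⊎; *↔× )
open import Data.List using (List; []; _∷_; map; lookup; length)
open import Data.List.Membership.Propositional using (_∈_; lose)
open import Data.List.Membership.Propositional.Properties using (∈-lookup)
import Data.List.Relation.Unary.All as ListAll
open import Data.List.Relation.Unary.AllPairs using (_∷_)
open import Data.List.Relation.Unary.Any as Any using (satisfied)
open import Data.List.Relation.Unary.Any.Properties using (lookup-index)
import Data.List.Relation.Unary.Unique.Setoid as UniqueSetoid
open import Data.Nat hiding (_≟_)
open import Data.Nat.DivMod using (_/_; m*n/n≡m)
open import Data.Nat.ListAction using () renaming (sum to listSum)
open import Data.Nat.Properties hiding (_≟_)
open import Data.Nat.Tactic.RingSolver using (solve-∀)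
open import Data.Parity using (Parity; 0ℙ; 1ℙ; _⁻¹)
open import Data.Parity.Properties using (suc-homo-⁻¹; +-homo-+; ⁻¹-involutive)
open import Data.Product using (Σ; ∃; _×_; _,_; proj₁; proj₂; uncurry)
open import Data.Product.Function.NonDependent.Propositional using (_×-↔_)
open import Data.Sum using (_⊎_; inj₁; inj₂)
open import Data.Sum.Function.Propositional using (_⊎-↔_)
open import Data.Vec using (Vec; []; _∷_; replicate)
open import Data.Vec.Relation.Unary.All using (All; []; _∷_; head; tail)
open import Data.Vec.Relation.Unary.Linked using (Linked)
open import Function.Base using (_∘_)
open import Function.Bundles using (_↔_; Inverse; Equivalence; mk↔ₛ′)
open import Function.Properties.Inverse using (↔-refl; ↔-sym; ↔-trans; ↔⇒⤖)
open import Relation.Binary.Bundles using (Setoid)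
open import Relation.Binary.PropositionalEquality
open import Relation.Nullary using (¬_; contradiction; yes; no)
open import Defs

open import Algebra.Properties.Semiring.Sum +-*-semiring
open Graph
open ≡-Reasoning

private variable
  d m n L : ℕ
  ns : Vec ℕ d

-- Consecutive numbers and parity.

Adj : ℕ → ℕ → Set
Adj x y = y ≡ suc x ⊎ x ≡ suc y

Adj-sym : ∀ {x y} → Adj x y → Adj y x
Adj-sym (inj₁ e) = inj₂ e
Adj-sym (inj₂ e) = inj₁ e

parity-suc : ∀ n → parity (suc n) ≡ parity n ⁻¹
parity-suc n = trans (sym (⁻¹-involutive _)) (cong _⁻¹ (suc-homo-⁻¹ n))

parity-Adj : ∀ {x y} → Adj x y → parity y ≡ parity x ⁻¹
parity-Adj {x} (inj₁ refl) = parity-suc x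
parity-Adj {y = y} (inj₂ refl) = sym (suc-homo-⁻¹ y)

-- Averages over a finite index set, computed through involutions.

Involutive : (Fin L → Fin L) → Set
Involutive ρ = ∀ p → ρ (ρ p) ≡ p

sum-involution : {ρ : Fin L → Fin L} → Involutive ρ → (f : Fin L → ℕ) → sum f ≡ sum (f ∘ ρ)
sum-involution {ρ = ρ} ρ² f = sum-permute f (permutation ρ ρ ρ² ρ²)

-- The average of f is k / 4.
record Mean (f : Fin L → ℕ) (k : ℕ) : Set where
  constructor mean
  field quadruple-sum : 4 * sum f ≡ L * k

sum-const : ∀ c → sum {L} (λ _ → c) ≡ L * c
sum-const {zero}  c = refl
sum-const {suc L} c = cong (c +_) (sum-const {L} c)

mean-const : ∀ c → Mean {L} (λ _ → c) (4 * c)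
mean-const {L} c = mean (begin
  4 * sum {L} (λ _ → c) ≡⟨ cong (4 *_) (sum-const {L} c) ⟩
  4 * (L * c)           ≡⟨ reorder L c ⟩
  L * (4 * c)           ∎)
  where
  reorder : ∀ m c → 4 * (m * c) ≡ m * (4 * c)
  reorder = solve-∀

mean-cong : ∀ {f g : Fin L → ℕ} {k} → f ≗ g → Mean f k → Mean g k
mean-cong f≗g (mean m) = mean (trans (cong (4 *_) (sym (sum-cong-≗ f≗g))) m)

mean-+ : ∀ {f g : Fin L → ℕ} {k l} → Mean f k → Mean g l → Mean (λ p → f p + g p) (k + l)
mean-+ {L} {f} {g} {k} {l} (mean mf) (mean mg) = mean (begin
  4 * sum (λ p → f p + g p) ≡⟨ cong (4 *_) (∑-distrib-+ f g) ⟩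
  4 * (sum f + sum g)       ≡⟨ *-distribˡ-+ 4 (sum f) (sum g) ⟩
  4 * sum f + 4 * sum g     ≡⟨ cong₂ _+_ mf mg ⟩
  L * k + L * l             ≡⟨ *-distribˡ-+ L k l ⟨
  L * (k + l)               ∎)

mean-* : ∀ c {f : Fin L → ℕ} {k} → Mean f k → Mean (λ p → c * f p) (c * k)
mean-* {L} c {f} {k} (mean mf) = mean (begin
  4 * sum (λ p → c * f p) ≡⟨ cong (4 *_) (*-distribˡ-sum c f) ⟨
  4 * (c * sum f)         ≡⟨ swap 4 c (sum f) ⟩
  c * (4 * sum f)         ≡⟨ cong (c *_) mf ⟩
  c * (L * k)             ≡⟨ swap c L k ⟩
  L * (c * k)             ∎)
  where
  swap : ∀ a b c → a * (b * c) ≡ b * (a * c)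
  swap = solve-∀

mean-∑ : ∀ {f : Fin d → Fin L → ℕ} {k : Fin d → ℕ} → (∀ i → Mean (f i) (k i)) →
         Mean (λ p → sum (λ i → f i p)) (sum k)
mean-∑ {zero}  m = mean-const 0
mean-∑ {suc d} m = mean-+ (m zero) (mean-∑ (m ∘ suc))

-- The functions `f`, `f ∘ ρ`, `f ∘ ρ′` and `f ∘ ρ′ ∘ ρ` are rearrangements of one another and so
-- have equal sums; four times the sum of `f` is therefore the sum of the constant `k`.
mean-square : ∀ {ρ ρ′ : Fin L → Fin L} {f k} → Involutive ρ → Involutive ρ′ →
  (∀ p → (f p + f (ρ p)) + (f (ρ′ p) + f (ρ′ (ρ p))) ≡ k) → Mean f k
mean-square {L} {ρ} {ρ′} {f} {k} ρ² ρ′² eq = mean (begin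
  4 * sum f
    ≡⟨ quadruple (sum f) ⟩
  (sum f + sum f) + (sum f + sum f)
    ≡⟨ cong₂ _+_ (cong (sum f +_) (sum-involution ρ² f))
                 (cong₂ _+_ f′ (trans f′ (sum-involution ρ² (f ∘ ρ′)))) ⟩
  (sum f + sum (f ∘ ρ)) + (sum (f ∘ ρ′) + sum (f ∘ ρ′ ∘ ρ))
    ≡⟨ cong₂ _+_ (∑-distrib-+ f (f ∘ ρ)) (∑-distrib-+ (f ∘ ρ′) (f ∘ ρ′ ∘ ρ)) ⟨
  sum (λ p → f p + f (ρ p)) + sum (λ p → f (ρ′ p) + f (ρ′ (ρ p)))
    ≡⟨ ∑-distrib-+ (λ p → f p + f (ρ p)) (λ p → f (ρ′ p) + f (ρ′ (ρ p))) ⟨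
  sum (λ p → (f p + f (ρ p)) + (f (ρ′ p) + f (ρ′ (ρ p))))
    ≡⟨ sum-cong-≗ eq ⟩
  sum {L} (λ _ → k)
    ≡⟨ sum-const {L} k ⟩
  L * k ∎)
  where
  f′ = sum-involution ρ′² f
  quadruple : ∀ s → 4 * s ≡ (s + s) + (s + s)
  quadruple = solve-∀

-- The degenerate square whose second involution is the identity: every pair is counted twice, hence
-- `k + k`.
mean-pair : ∀ {ρ : Fin L → Fin L} {f k} → Involutive ρ →
  (∀ p → f p + f (ρ p) ≡ k) → Mean f (k + k)
mean-pair {f = f} ρ² eq = mean-square {ρ′ = λ p → p} ρ² (λ _ → refl) (λ p → cong₂ _+_ (eq p) (eq p))

-- Reflecting a digit, with and without preserving its parity.

toℕ-opposite : (x : Fin n) → suc (toℕ x) + toℕ (opposite x) ≡ n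
toℕ-opposite {n} x = begin
  suc (toℕ x) + toℕ (opposite x) ≡⟨ cong (suc (toℕ x) +_) (opposite-prop x) ⟩
  suc (toℕ x) + (n ∸ suc (toℕ x)) ≡⟨ m+[n∸m]≡n (toℕ<n x) ⟩
  n ∎

reflect : Parity → Fin n → Fin n
reflect 0ℙ x = x
reflect 1ℙ x = opposite x

reflect-involutive : ∀ c (x : Fin n) → reflect c (reflect c x) ≡ x
reflect-involutive 0ℙ x = refl
reflect-involutive 1ℙ x = opposite-involutive x

reflect-pair : ∀ c (x : Fin n) → toℕ (reflect c x) + toℕ (reflect (c ⁻¹) x) ≡ pred n
reflect-pair 0ℙ x = cong pred (toℕ-opposite x)
reflect-pair 1ℙ x = trans (+-comm (toℕ (opposite x)) (toℕ x)) (cong pred (toℕ-opposite x))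

-- Reflection of {0,…,n-1}, corrected by ±1 when n is even so as to preserve parity.
data Mirror (n x y : ℕ) : Set where
  odd  : parity n ≡ 1ℙ → suc (x + y) ≡ n → Mirror n x y
  even-even : parity n ≡ 0ℙ → parity x ≡ 0ℙ → suc (suc (x + y)) ≡ n → Mirror n x y
  even-odd : parity n ≡ 0ℙ → parity x ≡ 1ℙ → x + y ≡ n → Mirror n x y

parity-+-even : ∀ x y → parity (x + y) ≡ 0ℙ → parity y ≡ parity x
parity-+-even x y e with parity x | parity y | trans (sym (+-homo-+ x y)) e
... | 0ℙ | 0ℙ | _ = refl
... | 1ℙ | 1ℙ | _ = refl

-- In every case `x + y` is even: it is n - 1 for odd n, and n - 2 or n for even n.
mirror-parity : ∀ {n x y} → Mirror n x y → parity y ≡ parity x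
mirror-parity {x = x} {y} (odd p e) = parity-+-even x y
  (trans (sym (suc-homo-⁻¹ (x + y))) (cong _⁻¹ (trans (cong parity e) p)))
mirror-parity {x = x} {y} (even-even p _ refl) = parity-+-even x y p
mirror-parity {x = x} {y} (even-odd p _ refl) = parity-+-even x y p

mirror-sym : ∀ {n x y} → Mirror n x y → Mirror n y x
mirror-sym {x = x} {y} (odd p e) = odd p (trans (cong suc (+-comm y x)) e)
mirror-sym {x = x} {y} m@(even-even p q e) =
  even-even p (trans (mirror-parity m) q) (trans (cong 2+ (+-comm y x)) e)
mirror-sym {x = x} {y} m@(even-odd p q e) =
  even-odd p (trans (mirror-parity m) q) (trans (+-comm y x) e)

parity-clash : ∀ {p} → p ≡ 0ℙ → p ≡ 1ℙ → ∀ {a} {A : Set a} → A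
parity-clash refl ()

mirror-functional : ∀ {n x y z} → Mirror n x y → Mirror n x z → y ≡ z
mirror-functional {x = x} (odd _ e) (odd _ f) = +-cancelˡ-≡ (suc x) _ _ (trans e (sym f))
mirror-functional {x = x} (even-even _ _ e) (even-even _ _ f) =
  +-cancelˡ-≡ (suc (suc x)) _ _ (trans e (sym f))
mirror-functional {x = x} (even-odd _ _ e) (even-odd _ _ f) = +-cancelˡ-≡ x _ _ (trans e (sym f))
mirror-functional (odd p _) (even-even q _ _) = parity-clash q p
mirror-functional (odd p _) (even-odd q _ _) = parity-clash q p
mirror-functional (even-even q _ _) (odd p _) = parity-clash q p
mirror-functional (even-odd q _ _) (odd p _) = parity-clash q p
mirror-functional (even-even _ q _) (even-odd _ p _) = parity-clash q p
mirror-functional (even-odd _ p _) (even-even _ q _) = parity-clash q p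

mirror-exists : (x : Fin n) → Σ (Fin n) λ y → Mirror n (toℕ x) (toℕ y)
mirror-exists {n} x with parity n in pn | parity (toℕ x) in px
... | 1ℙ | _  = opposite x , odd pn (toℕ-opposite x)
... | 0ℙ | 1ℙ = fromℕ< y<n , even-odd pn px
    (trans (cong (toℕ x +_) (toℕ-fromℕ< y<n)) (m+[n∸m]≡n (<⇒≤ (toℕ<n x))))
  where
  0<x : 0 < toℕ x
  0<x = n≢0⇒n>0 λ e → parity-clash (cong parity e) px
  y<n : n ∸ toℕ x < n
  y<n = ∸-monoʳ-< 0<x (<⇒≤ (toℕ<n x))
... | 0ℙ | 0ℙ = fromℕ< y<n , even-even pn px
    (trans (cong (λ y → 2+ (toℕ x + y)) (toℕ-fromℕ< y<n)) (m+[n∸m]≡n x+2≤n))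
  where
  x+2≤n : suc (suc (toℕ x)) ≤ n
  -- Both `n` and `x` are even here, so `n` cannot be the successor of `x`.
  x+2≤n = ≤∧≢⇒< (toℕ<n x) λ e → parity-clash pn
    (trans (cong parity (sym e)) (trans (parity-suc (toℕ x)) (cong _⁻¹ px)))
  y<n : n ∸ suc (suc (toℕ x)) < n
  y<n = ∸-monoʳ-< z<s x+2≤n

par : Fin n → Parity
par x = parity (toℕ x)

mirror : Parity → Fin n → Fin n
mirror 0ℙ x = x
mirror 1ℙ x = proj₁ (mirror-exists x)

mirror-involutive : ∀ c (x : Fin n) → mirror c (mirror c x) ≡ x
mirror-involutive 0ℙ x = refl
mirror-involutive 1ℙ x = toℕ-injective (mirror-functional
  (proj₂ (mirror-exists (proj₁ (mirror-exists x)))) (mirror-sym (proj₂ (mirror-exists x))))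

par-mirror : ∀ c (x : Fin n) → par (mirror c x) ≡ par x
par-mirror 0ℙ x = refl
par-mirror 1ℙ x = mirror-parity (proj₂ (mirror-exists x))

-- For odd n both sums equal n - 1. For even n one equals n - 2 and the other n, because `x` and
-- `suc x` differ in parity. Thus the corrections by one cancel between neighbours.
mirror-step : ∀ {n x y z} → Mirror n x y → Mirror n (suc x) z → (x + y) + (suc x + z) ≡ pred n + pred n
mirror-step (odd _ e) (odd _ e′) = cong₂ _+_ (cong pred e) (cong pred e′)
mirror-step {x = x} {y} (even-even _ _ refl) (even-odd _ _ e′) =
  trans (cong (x + y +_) e′) (+-suc (x + y) (suc (x + y)))
mirror-step {x = x} {z = z} (even-odd _ _ e) (even-even _ _ refl) =
  trans (cong (_+ (suc x + z)) e) (cong suc (sym (+-suc (suc x + z) (suc x + z))))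
mirror-step {x = x} (even-even _ p _) (even-even _ q _) = parity-clash q (trans (parity-suc x) (cong _⁻¹ p))
mirror-step {x = x} (even-odd _ p _) (even-odd _ q _) = parity-clash (trans (parity-suc x) (cong _⁻¹ p)) q
mirror-step (odd p _) (even-even q _ _) = parity-clash q p
mirror-step (odd p _) (even-odd q _ _) = parity-clash q p
mirror-step (even-even q _ _) (odd p _) = parity-clash q p
mirror-step (even-odd q _ _) (odd p _) = parity-clash q p

-- Whatever `c` is, the four terms are `x`, `y` and their mirror images; `c` only decides in which
-- order they appear.
mirror-square : ∀ c {x y : Fin n} → Adj (toℕ x) (toℕ y) →
  (toℕ (mirror c x) + toℕ (mirror c y)) + (toℕ (mirror (c ⁻¹) x) + toℕ (mirror (c ⁻¹) y)) ≡ pred n + pred n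
mirror-square {n} c {x} {y} adj = by-parity c
  where
  x′ = mirror 1ℙ x
  y′ = mirror 1ℙ y
  across : ∀ {x y x′ y′} → Mirror n x x′ → Mirror n y y′ → Adj x y → (x + x′) + (y + y′) ≡ pred n + pred n
  across m m′ (inj₁ refl) = mirror-step m m′
  across {x} {y} {x′} {y′} m m′ (inj₂ refl) = trans (+-comm (x + x′) (y + y′)) (mirror-step m′ m)
  reorder₀ : ∀ a b a′ b′ → (a + b) + (a′ + b′) ≡ (a + a′) + (b + b′)
  reorder₀ = solve-∀
  reorder₁ : ∀ a b a′ b′ → (a′ + b′) + (a + b) ≡ (a + a′) + (b + b′)
  reorder₁ = solve-∀
  total : (toℕ x + toℕ x′) + (toℕ y + toℕ y′) ≡ pred n + pred n
  total = across (proj₂ (mirror-exists x)) (proj₂ (mirror-exists y)) adj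
  by-parity : ∀ c → (toℕ (mirror c x) + toℕ (mirror c y))
    + (toℕ (mirror (c ⁻¹) x) + toℕ (mirror (c ⁻¹) y)) ≡ pred n + pred n
  by-parity 0ℙ = trans (reorder₀ (toℕ x) (toℕ y) (toℕ x′) (toℕ y′)) total
  by-parity 1ℙ = trans (reorder₁ (toℕ x) (toℕ y) (toℕ x′) (toℕ y′)) total

-- Steps along an axis, and unit cubes.

coord : {ns : Vec ℕ d} → Fin d → All Fin ns → ℕ
coord {ns = _ ∷ _} zero    u = toℕ (head u)
coord {ns = _ ∷ _} (suc i) u = coord i (tail u)

coord-ext : {u v : All Fin ns} → (∀ i → coord i u ≡ coord i v) → u ≡ v
coord-ext {u = []}     {[]}     eq = refl
coord-ext {u = x ∷ us} {y ∷ vs} eq = cong₂ _∷_ (toℕ-injective (eq zero)) (coord-ext (eq ∘ suc))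

record Step {d} {ns : Vec ℕ d} (i : Fin d) (u v : All Fin ns) : Set where
  constructor mkStep
  field
    moves : Adj (coord i u) (coord i v)
    fixes : ∀ {j} → j ≢ i → coord j u ≡ coord j v

open Step using (moves; fixes)

step-tail : ∀ {i} {u v : All Fin (n ∷ ns)} → Step (suc i) u v → Step i (tail u) (tail v)
step-tail s = mkStep (moves s) (λ {j} j≢i → fixes s {suc j} λ { refl → j≢i refl })

step-head≡ : ∀ {i} {u v : All Fin (n ∷ ns)} → Step (suc i) u v → head u ≡ head v
step-head≡ s = toℕ-injective (fixes s {zero} λ ())

step-tail≡ : {u v : All Fin (n ∷ ns)} → Step zero u v → tail u ≡ tail v
step-tail≡ s = coord-ext λ i → fixes s {suc i} λ ()

-- `v` may repeat vertices, and `commute` compares vertices rather than indices. This allows a cube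
-- to be projected while keeping its index set.
record Cube {d} (ns : Vec ℕ d) (L : ℕ) : Set where
  field
    v       : Fin L → All Fin ns
    τ       : Fin d → Fin L → Fin L
    τ²      : ∀ i → Involutive (τ i)
    step    : ∀ i p → Step i (v p) (v (τ i p))
    commute : ∀ {i j} → i ≢ j → ∀ p → v (τ i (τ j p)) ≡ v (τ j (τ i p))

-- After projection the indices `p` and `τ zero p` give the same point. Averages over the index set
-- are insensitive to this, which makes recursion on the coordinates possible.
tailCube : Cube (n ∷ ns) L → Cube ns L
tailCube C = record
  { v       = tail ∘ v
  ; τ       = τ ∘ suc
  ; τ²      = τ² ∘ suc
  ; step    = λ i p → step-tail (step (suc i) p)
  ; commute = λ i≢j p → cong tail (commute (λ { refl → i≢j refl }) p)
  }
  where open Cube C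

-- Mixed-radix codes of vertices and edges, and their twists.

vertexCount : Vec ℕ d → ℕ
vertexCount []       = 1
vertexCount (n ∷ ns) = n * vertexCount ns

vertex↔ : (ns : Vec ℕ d) → All Fin ns ↔ Fin (vertexCount ns)
vertex↔ []       = mk↔ₛ′ (λ _ → zero) (λ _ → []) (λ { zero → refl }) (λ { [] → refl })
vertex↔ (n ∷ ns) = ↔-trans split (↔-trans (↔-refl ×-↔ vertex↔ ns) (↔-sym *↔×))
  where
  split : All Fin (n ∷ ns) ↔ (Fin n × All Fin ns)
  split = mk↔ₛ′ (λ u → head u , tail u) (λ (x , u) → x ∷ u) (λ _ → refl) (λ { (_ ∷ _) → refl })

vertexCode : All Fin ns → ℕ
vertexCode {ns = ns} u = toℕ (Inverse.to (vertex↔ ns) u)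

vertexCode-∷ : (u : All Fin (n ∷ ns)) →
  vertexCode u ≡ vertexCount ns * toℕ (head u) + vertexCode (tail u)
vertexCode-∷ u = toℕ-combine (head u) _

mirrorAll : Parity → All Fin ns → All Fin ns
mirrorAll {ns = []}    c u = []
mirrorAll {ns = _ ∷ _} c u = mirror c (head u) ∷ mirrorAll c (tail u)

-- The second coordinate controls the first digit, and the first coordinate controls all the others.
-- Every digit thus has a controlling coordinate different from its own.
twist : {ns : Vec ℕ d} → All Fin (n ∷ ns) → All Fin (n ∷ ns)
twist {ns = []}    u = u
twist {ns = _ ∷ _} u = mirror (par (head (tail u))) (head u) ∷ mirrorAll (par (head u)) (tail u)

mirrorAll-involutive : ∀ c (u : All Fin ns) → mirrorAll c (mirrorAll c u) ≡ u
mirrorAll-involutive c []      = refl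
mirrorAll-involutive c (x ∷ u) = cong₂ _∷_ (mirror-involutive c x) (mirrorAll-involutive c u)

-- Mirroring preserves parity, so the second application sees the same controlling parities as the
-- first.
twist-involutive : (u : All Fin (n ∷ ns)) → twist (twist u) ≡ u
twist-involutive (x ∷ [])    = refl
twist-involutive (x ∷ y ∷ u)
  rewrite par-mirror (par x) y | par-mirror (par y) x =
  cong₂ _∷_ (mirror-involutive (par y) x) (mirrorAll-involutive (par x) (y ∷ u))

-- Canonical form of an unoriented edge: `here l u` runs along the first axis, from `l` to `l + 1`,
-- with transverse coordinates `u`; `there x e` runs along a later axis, at first coordinate `x`.
data GridEdge : Vec ℕ d → Set where
  here  : Fin (pred n) → All Fin ns → GridEdge (n ∷ ns)
  there : Fin n → GridEdge ns → GridEdge (n ∷ ns)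

edgeCount : Vec ℕ d → ℕ
edgeCount []       = 0
edgeCount (n ∷ ns) = pred n * vertexCount ns + n * edgeCount ns

edge↔ : (ns : Vec ℕ d) → GridEdge ns ↔ Fin (edgeCount ns)
edge↔ []       = mk↔ₛ′ (λ ()) (λ ()) (λ ()) (λ ())
edge↔ (n ∷ ns) = ↔-trans split
  (↔-trans (↔-trans (↔-refl ×-↔ vertex↔ ns) (↔-sym *↔×)
            ⊎-↔ ↔-trans (↔-refl ×-↔ edge↔ ns) (↔-sym *↔×))
           (↔-sym +↔⊎))
  where
  split : GridEdge (n ∷ ns) ↔ ((Fin (pred n) × All Fin ns) ⊎ (Fin n × GridEdge ns))
  split = mk↔ₛ′
    (λ { (here l u) → inj₁ (l , u) ; (there x e) → inj₂ (x , e) })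
    (λ { (inj₁ (l , u)) → here l u ; (inj₂ (x , e)) → there x e })
    (λ { (inj₁ _) → refl ; (inj₂ _) → refl })
    (λ { (here _ _) → refl ; (there _ _) → refl })

edgeCode : GridEdge ns → ℕ
edgeCode {ns = ns} e = toℕ (Inverse.to (edge↔ ns) e)

edgeCode-here : ∀ l (u : All Fin ns) →
  edgeCode {ns = n ∷ ns} (here l u) ≡ vertexCount ns * toℕ l + vertexCode u
edgeCode-here l u = trans (toℕ-↑ˡ (combine l _) _) (toℕ-combine l _)

edgeCode-there : ∀ x (e : GridEdge ns) →
  edgeCode {ns = n ∷ ns} (there x e) ≡ pred n * vertexCount ns + (edgeCount ns * toℕ x + edgeCode e)
edgeCode-there {ns = ns} {n = n} x e =
  trans (toℕ-↑ʳ (pred n * vertexCount ns) _) (cong (pred n * vertexCount ns +_) (toℕ-combine x _))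

-- The coordinate along the edge is the same seen from both ends, and its parity never controls
-- another digit, so it undergoes plain reflection. Transverse coordinates are mirrored, which keeps
-- their parities available as controls.
flipEdge : Parity → GridEdge ns → GridEdge ns
flipEdge c (here l u)  = here (reflect c l) (mirrorAll c u)
flipEdge c (there x e) = there (mirror c x) (flipEdge c e)

flipEdge-involutive : ∀ c (e : GridEdge ns) → flipEdge c (flipEdge c e) ≡ e
flipEdge-involutive c (here l u)  = cong₂ here (reflect-involutive c l) (mirrorAll-involutive c u)
flipEdge-involutive c (there x e) = cong₂ there (mirror-involutive c x) (flipEdge-involutive c e)

-- The parity of a coordinate transverse to the edge.
transverse : ∀ {m} → GridEdge (n ∷ m ∷ ns) → Parity
transverse (here l u)  = par (head u)
transverse (there x e) = par x

transverse-flipEdge : ∀ {m} c (e : GridEdge (n ∷ m ∷ ns)) → transverse (flipEdge c e) ≡ transverse e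
transverse-flipEdge c (here l u)  = par-mirror c (head u)
transverse-flipEdge c (there x e) = par-mirror c x

-- With at least three axes every edge has two transverse coordinates. One of them controls the
-- digits other than itself, and the second one controls the first.
twistEdge : ∀ {l m} → GridEdge (l ∷ m ∷ n ∷ ns) → GridEdge (l ∷ m ∷ n ∷ ns)
twistEdge (here l u)  = here (reflect (par (head u)) l) (twist u)
twistEdge (there x e) = there (mirror (transverse e) x) (flipEdge (par x) e)

twistEdge-involutive : ∀ {l m} (e : GridEdge (l ∷ m ∷ n ∷ ns)) → twistEdge (twistEdge e) ≡ e
twistEdge-involutive (here l u) = cong₂ here
  (trans (cong (λ c → reflect c (reflect (par (head u)) l)) (par-mirror (par (head (tail u))) (head u)))
         (reflect-involutive (par (head u)) l))
  (twist-involutive u)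
twistEdge-involutive (there x e)
  rewrite par-mirror (transverse e) x | transverse-flipEdge (par x) e =
  cong₂ there (mirror-involutive (transverse e) x) (flipEdge-involutive (par x) e)

-- The canonical edge under a step.

Adj⇒⊓<pred : {x y : Fin n} → Adj (toℕ x) (toℕ y) → toℕ x ⊓ toℕ y < pred n
Adj⇒⊓<pred {x = x} {y} (inj₁ e) =
  ≤-<-trans (m⊓n≤m (toℕ x) (toℕ y)) (pred-mono-≤ (subst (_< _) e (toℕ<n y)))
Adj⇒⊓<pred {x = x} {y} (inj₂ e) =
  ≤-<-trans (m⊓n≤n (toℕ x) (toℕ y)) (pred-mono-≤ (subst (_< _) e (toℕ<n x)))

-- Irrelevance of the adjacency proof makes the result depend on the two ends alone; `edgeAt` uses
-- it for the same purpose.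
low : (x y : Fin n) → .(Adj (toℕ x) (toℕ y)) → Fin (pred n)
low x y adj = fromℕ< (Adj⇒⊓<pred {x = x} {y} adj)

low-cong : {x x′ y y′ : Fin n} .(a : Adj (toℕ x) (toℕ y)) .(a′ : Adj (toℕ x′) (toℕ y′)) →
           x ≡ x′ → y ≡ y′ → low x y a ≡ low x′ y′ a′
low-cong _ _ refl refl = refl

edgeAt : ∀ {ns : Vec ℕ d} i (u v : All Fin ns) → .(Step i u v) → GridEdge ns
edgeAt {ns = _ ∷ _} zero    u v s = here (low (head u) (head v) (moves s)) (tail u)
edgeAt {ns = _ ∷ _} (suc i) u v s = there (head u) (edgeAt i (tail u) (tail v) (step-tail s))

edgeAt-cong : ∀ {i} {u u′ v v′ : All Fin ns} .(s : Step i u v) .(s′ : Step i u′ v′) →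
              u ≡ u′ → v ≡ v′ → edgeAt i u v s ≡ edgeAt i u′ v′ s′
edgeAt-cong _ _ refl refl = refl

cubeEdge : Cube {d} ns L → Fin d → Fin L → GridEdge ns
cubeEdge C i p = edgeAt i (v p) (v (τ i p)) (step i p)
  where open Cube C

-- Averages of twisted codes over a cube.

-- `ρ` moves the digit to its neighbour and keeps the control, while `ρ′` keeps the digit and
-- toggles the control. The four combinations are those of `mirror-square`.
mean-mirror : ∀ {x : Fin L → Fin n} {c : Fin L → Parity} {ρ ρ′ : Fin L → Fin L} →
  Involutive ρ → Involutive ρ′ →
  (∀ p → Adj (toℕ (x p)) (toℕ (x (ρ p)))) → (∀ p → c (ρ p) ≡ c p) →
  (∀ p → x (ρ′ p) ≡ x p) → (∀ p → c (ρ′ p) ≡ c p ⁻¹) →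
  Mean (λ p → toℕ (mirror (c p) (x p))) (pred n + pred n)
mean-mirror {n = n} {x = x} {c} {ρ} {ρ′} ρ² ρ′² adj c-ρ x-ρ′ c-ρ′ = mean-square ρ² ρ′² square
  where
  square : ∀ p → (toℕ (mirror (c p) (x p)) + toℕ (mirror (c (ρ p)) (x (ρ p))))
    + (toℕ (mirror (c (ρ′ p)) (x (ρ′ p))) + toℕ (mirror (c (ρ′ (ρ p))) (x (ρ′ (ρ p))))) ≡ pred n + pred n
  square p rewrite c-ρ′ (ρ p) | c-ρ p | c-ρ′ p | x-ρ′ p | x-ρ′ (ρ p) = mirror-square (c p) (adj p)

mean-reflect : ∀ {x : Fin L → Fin n} {c : Fin L → Parity} {ρ : Fin L → Fin L} →
  Involutive ρ → (∀ p → x (ρ p) ≡ x p) → (∀ p → c (ρ p) ≡ c p ⁻¹) →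
  Mean (λ p → toℕ (reflect (c p) (x p))) (pred n + pred n)
mean-reflect {n = n} {x = x} {c} {ρ} ρ² x-ρ c-ρ = mean-pair ρ² pair
  where
  pair : ∀ p → toℕ (reflect (c p) (x p)) + toℕ (reflect (c (ρ p)) (x (ρ p))) ≡ pred n
  pair p rewrite c-ρ p | x-ρ p = reflect-pair (c p) (x p)

-- Four times the average code: each digit averages (n - 1) / 2 and is weighted by its place value.
vertexMean : Vec ℕ d → ℕ
vertexMean []       = 0
vertexMean (n ∷ ns) = vertexCount ns * (pred n + pred n) + vertexMean ns

-- `ρ` stands for a step along an axis that has been projected away: it is invisible to `v` but
-- toggles the control.
mean-mirrorAll : (C : Cube ns L) → let open Cube C in {c : Fin L → Parity} {ρ : Fin L → Fin L} →
  Involutive ρ → (∀ p → v (ρ p) ≡ v p) → (∀ p → c (ρ p) ≡ c p ⁻¹) → (∀ i p → c (τ i p) ≡ c p) →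
  Mean (λ p → vertexCode (mirrorAll (c p) (v p))) (vertexMean ns)
mean-mirrorAll {ns = []}     C _ _ _ _ = mean-const 0
mean-mirrorAll {ns = n ∷ ns} C {c} ρ² v-ρ c-ρ c-τ =
  mean-cong (λ p → sym (vertexCode-∷ (mirrorAll (c p) (v p))))
    (mean-+ (mean-* (vertexCount ns)
              (mean-mirror (τ² zero) ρ² (moves ∘ step zero) (c-τ zero) (cong head ∘ v-ρ) c-ρ))
            (mean-mirrorAll (tailCube C) ρ² (cong tail ∘ v-ρ) c-ρ (c-τ ∘ suc)))
  where open Cube C

-- `τ (suc zero)` toggles the control of the first digit without moving that digit; `τ zero` does
-- the same for all later digits.
mean-twist : ∀ {m} (C : Cube (n ∷ m ∷ ns) L) → let open Cube C in
  Mean (λ p → vertexCode (twist (v p))) (vertexMean (n ∷ m ∷ ns))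
mean-twist {ns = ns} {m = m} C = mean-cong (λ p → sym (vertexCode-∷ (twist (v p))))
  (mean-+ (mean-* (vertexCount (m ∷ ns))
            (mean-mirror (τ² zero) (τ² (suc zero)) (moves ∘ step zero)
              (λ p → cong (par ∘ head) (sym (step-tail≡ (step zero p))))
              (λ p → sym (step-head≡ (step (suc zero) p)))
              (λ p → parity-Adj (moves (step (suc zero) p)))))
          (mean-mirrorAll (tailCube C) (τ² zero)
            (λ p → sym (step-tail≡ (step zero p)))
            (λ p → parity-Adj (moves (step zero p)))
            (λ i p → cong par (sym (step-head≡ (step (suc i) p))))))
  where open Cube C

-- Four times the average code of the edges along axis `i`. The coordinate along the edge has only n
-- - 1 positions, hence the double `pred`; the summand with factor 4 is the offset past the edges
-- along the first axis.
edgeMean : {ns : Vec ℕ d} → Fin d → ℕ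
edgeMean {ns = n ∷ ns} zero    = vertexCount ns * (pred (pred n) + pred (pred n)) + vertexMean ns
edgeMean {ns = n ∷ ns} (suc i) =
  4 * (pred n * vertexCount ns) + (edgeCount ns * (pred n + pred n) + edgeMean {ns = ns} i)

-- As in `mean-mirrorAll`; in addition `ρ` must be invisible at the far end of the edge, so that it
-- preserves the position along the edge.
mean-flipEdge : (C : Cube {d} ns L) → let open Cube C in
  (i : Fin d) {c : Fin L → Parity} {ρ : Fin L → Fin L} →
  Involutive ρ → (∀ p → v (ρ p) ≡ v p) → (∀ p → v (τ i (ρ p)) ≡ v (τ i p)) →
  (∀ p → c (ρ p) ≡ c p ⁻¹) → (∀ j p → c (τ j p) ≡ c p) →
  Mean (λ p → edgeCode (flipEdge (c p) (cubeEdge C i p))) (edgeMean {ns = ns} i)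
mean-flipEdge {ns = n ∷ ns} C zero {c} {ρ} ρ² v-ρ vτ-ρ c-ρ c-τ =
  mean-cong (λ p → sym (edgeCode-here {n = n} (reflect (c p) (l p)) (mirrorAll (c p) (tail (v p)))))
    (mean-+ (mean-* (vertexCount ns) (mean-reflect {x = l} ρ²
              (λ p → low-cong (moves (step zero (ρ p))) (moves (step zero p))
                (cong head (v-ρ p)) (cong head (vτ-ρ p)))
              c-ρ))
            (mean-mirrorAll (tailCube C) ρ² (cong tail ∘ v-ρ) c-ρ (c-τ ∘ suc)))
  where
  open Cube C
  l = λ p → low (head (v p)) (head (v (τ zero p))) (moves (step zero p))
mean-flipEdge {ns = n ∷ ns} C (suc i) {c} ρ² v-ρ vτ-ρ c-ρ c-τ =
  mean-cong (λ p → sym (edgeCode-there (mirror (c p) (head (v p)))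
                                       (flipEdge (c p) (cubeEdge (tailCube C) i p))))
    (mean-+ (mean-const (pred n * vertexCount ns))
      (mean-+ (mean-* (edgeCount ns)
                (mean-mirror (τ² zero) ρ² (moves ∘ step zero) (c-τ zero) (cong head ∘ v-ρ) c-ρ))
              (mean-flipEdge (tailCube C) i ρ² (cong tail ∘ v-ρ) (cong tail ∘ vτ-ρ) c-ρ (c-τ ∘ suc))))
  where open Cube C

mean-twistEdge : ∀ {l m} {ns : Vec ℕ d} (C : Cube (l ∷ m ∷ n ∷ ns) L) i →
  Mean (λ p → edgeCode (twistEdge (cubeEdge C i p))) (edgeMean {ns = l ∷ m ∷ n ∷ ns} i)
mean-twistEdge {n = n} {l = l} {m} {ns} C zero =
  mean-cong (λ p → sym (edgeCode-here {n = l} (reflect (par (head (tail (v p)))) (lo p))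
                                      (twist (tail (v p)))))
    (mean-+ (mean-* (vertexCount (m ∷ n ∷ ns))
              (mean-reflect {x = lo} (τ² (suc zero))
                (λ p → low-cong (moves (step zero (τ (suc zero) p))) (moves (step zero p))
                  (sym (step-head≡ (step (suc zero) p)))
                  -- The far end also moves along the second axis only: `commute` turns it into a
                  -- step from `v (τ zero p)`, which keeps the first coordinate.
                  (trans (cong head (commute (λ ()) p)) (sym (step-head≡ (step (suc zero) (τ zero p))))))
                (λ p → parity-Adj (moves (step (suc zero) p)))))
            (mean-twist (tailCube C)))
  where
  open Cube C
  lo = λ p → low (head (v p)) (head (v (τ zero p))) (moves (step zero p))
mean-twistEdge {d = d} {n = n} {L = L} {l = l} {m} {ns} C (suc i) =
  mean-cong (λ p → sym (edgeCode-there (mirror (transverse (e p)) (head (v p)))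
                                       (flipEdge (par (head (v p))) (e p))))
    (mean-+ (mean-const (pred l * vertexCount (m ∷ n ∷ ns)))
      (mean-+ (mean-* (edgeCount (m ∷ n ∷ ns))
                (mean-mirror (τ² zero) (τ² (suc (other i))) (moves ∘ step zero)
                  (λ p → cong transverse
                    (edgeAt-cong (step-tail (step (suc i) (τ zero p))) (step-tail (step (suc i) p))
                      (tail-τ₀ p) (tail-ττ₀ p)))
                  (λ p → sym (step-head≡ (step (suc (other i)) p)))
                  (other-flips i)))
              (mean-flipEdge (tailCube C) i (τ² zero) tail-τ₀ tail-ττ₀
                (λ p → parity-Adj (moves (step zero p)))
                (λ j p → cong par (sym (step-head≡ (step (suc j) p)))))))
  where
  open Cube C
  e = cubeEdge (tailCube C) i
  tail-τ₀ : ∀ p → tail (v (τ zero p)) ≡ tail (v p)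
  tail-τ₀ p = sym (step-tail≡ (step zero p))
  tail-ττ₀ : ∀ p → tail (v (τ (suc i) (τ zero p))) ≡ tail (v (τ (suc i) p))
  tail-ττ₀ p = trans (cong tail (commute (λ ()) p)) (tail-τ₀ (τ (suc i) p))
  -- The axis, counted after the first, of the coordinate that `transverse` reads: the first of
  -- these axes, unless the edge itself runs along it, and then the second.
  other : Fin (suc (suc d)) → Fin (suc (suc d))
  other zero    = suc zero
  other (suc _) = zero
  other-flips : ∀ i p → transverse (cubeEdge (tailCube C) i (τ (suc (other i)) p))
                        ≡ transverse (cubeEdge (tailCube C) i p) ⁻¹
  other-flips zero    p = parity-Adj (moves (step (suc (suc zero)) p))
  other-flips (suc i) p = parity-Adj (moves (step (suc zero) p))

-- Edges of the grid graph and their canonical forms.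

∣-∣≡1⇒Adj : ∀ x y → ∣ x - y ∣ ≡ 1 → Adj x y
∣-∣≡1⇒Adj zero    y       e = inj₁ e
∣-∣≡1⇒Adj (suc x) zero    e = inj₂ e
∣-∣≡1⇒Adj (suc x) (suc y) e with ∣-∣≡1⇒Adj x y e
... | inj₁ refl = inj₁ refl
... | inj₂ refl = inj₂ refl

Adj⇒∣-∣≡1 : ∀ x y → Adj x y → ∣ x - y ∣ ≡ 1
Adj⇒∣-∣≡1 x _ (inj₁ refl) = trans (∣-∣-comm x (suc x)) (Adj⇒∣-∣≡1 (suc x) x (inj₂ refl))
Adj⇒∣-∣≡1 _ zero    (inj₂ refl) = refl
Adj⇒∣-∣≡1 _ (suc y) (inj₂ refl) = Adj⇒∣-∣≡1 (suc y) y (inj₂ refl)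

dist≡0⇒≡ : (u v : All Fin ns) → dist u v ≡ 0 → u ≡ v
dist≡0⇒≡ []      []      e = refl
dist≡0⇒≡ (x ∷ u) (y ∷ v) e = cong₂ _∷_
  (toℕ-injective (∣m-n∣≡0⇒m≡n (m+n≡0⇒m≡0 ∣ toℕ x - toℕ y ∣ e)))
  (dist≡0⇒≡ u v (m+n≡0⇒n≡0 ∣ toℕ x - toℕ y ∣ e))

step-here : {x y : Fin n} {u : All Fin ns} → Adj (toℕ x) (toℕ y) → Step zero (x ∷ u) (y ∷ u)
step-here adj = mkStep adj λ { {zero} 0≢0 → contradiction refl 0≢0 ; {suc j} _ → refl }

step-there : ∀ {x : Fin n} {i} {u v : All Fin ns} → Step i u v → Step (suc i) (x ∷ u) (x ∷ v)
step-there s = mkStep (moves s) λ { {zero} _ → refl ; {suc j} j≢i → fixes s (j≢i ∘ cong suc) }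

step-sym : ∀ {i} {u v : All Fin ns} → Step i u v → Step i v u
step-sym s = mkStep (Adj-sym (moves s)) (sym ∘ fixes s)

dist≡1⇒step : (u v : All Fin ns) → dist u v ≡ 1 → ∃ λ i → Step i u v
dist≡1⇒step []      []      ()
dist≡1⇒step (x ∷ u) (y ∷ v) e with ∣ toℕ x - toℕ y ∣ in x-y
... | 0 with refl ← toℕ-injective {i = x} {y} (∣m-n∣≡0⇒m≡n x-y) =
  let i , s = dist≡1⇒step u v e in suc i , step-there s
... | 1 with refl ← dist≡0⇒≡ u v (suc-injective e) = zero , step-here (∣-∣≡1⇒Adj (toℕ x) (toℕ y) x-y)

step⇒dist≡1 : ∀ {i} {u v : All Fin ns} → Step i u v → dist u v ≡ 1
step⇒dist≡1 {i = zero}  {x ∷ u} {y ∷ v} s with refl ← step-tail≡ s =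
  cong₂ _+_ (Adj⇒∣-∣≡1 (toℕ x) (toℕ y) (moves s)) (dist-refl u)
step⇒dist≡1 {i = suc i} {x ∷ u} {y ∷ v} s with refl ← step-head≡ s =
  cong₂ _+_ (∣n-n∣≡0 (toℕ x)) (step⇒dist≡1 (step-tail s))

data Joined : {ns : Vec ℕ d} → GridEdge ns → All Fin ns → All Fin ns → Set where
  up    : ∀ {l : Fin (pred n)} {x y : Fin n} {u : All Fin ns} → toℕ x ≡ toℕ l → toℕ y ≡ suc (toℕ l) →
          Joined (here l u) (x ∷ u) (y ∷ u)
  down  : ∀ {l : Fin (pred n)} {x y : Fin n} {u : All Fin ns} → toℕ x ≡ suc (toℕ l) → toℕ y ≡ toℕ l →
          Joined (here l u) (x ∷ u) (y ∷ u)
  along : ∀ {x : Fin n} {e : GridEdge ns} {u v} → Joined e u v → Joined (there x e) (x ∷ u) (x ∷ v)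

edgeAt-joined : ∀ i (u v : All Fin ns) (s : Step i u v) → Joined (edgeAt i u v s) u v
edgeAt-joined zero (x ∷ u) (y ∷ v) s with refl ← step-tail≡ s | moves s
... | inj₁ e = up (trans (sym x⊓y) (sym lo)) (trans e (cong suc (trans (sym x⊓y) (sym lo))))
  where
  x⊓y : toℕ x ⊓ toℕ y ≡ toℕ x
  x⊓y = m≤n⇒m⊓n≡m (subst (toℕ x ≤_) (sym e) (n≤1+n _))
  lo : toℕ (low x y (moves s)) ≡ toℕ x ⊓ toℕ y
  lo = toℕ-fromℕ< _
... | inj₂ e = down (trans e (cong suc (trans (sym x⊓y) (sym lo)))) (trans (sym x⊓y) (sym lo))
  where
  x⊓y : toℕ x ⊓ toℕ y ≡ toℕ y
  x⊓y = m≥n⇒m⊓n≡n (subst (toℕ y ≤_) (sym e) (n≤1+n _))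
  lo : toℕ (low x y (moves s)) ≡ toℕ x ⊓ toℕ y
  lo = toℕ-fromℕ< _
edgeAt-joined (suc i) (x ∷ u) (y ∷ v) s with refl ← step-head≡ s = along (edgeAt-joined i u v (step-tail s))

joined-sym : ∀ {e : GridEdge ns} {u v} → Joined e u v → Joined e v u
joined-sym (up p q)   = down q p
joined-sym (down p q) = up q p
joined-sym (along j)  = along (joined-sym j)

joined-step : ∀ {e : GridEdge ns} {u v} → Joined e u v → ∃ λ i → Step i u v
joined-step (up p q)   = zero , step-here (inj₁ (trans q (cong suc (sym p))))
joined-step (down p q) = zero , step-here (inj₂ (trans p (cong suc (sym q))))
joined-step (along j)  = let i , s = joined-step j in suc i , step-there s

joined-dist : ∀ {e : GridEdge ns} {u v} → Joined e u v → dist u v ≡ 1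
joined-dist j = step⇒dist≡1 (proj₂ (joined-step j))

joined-irreflexive : ∀ {e : GridEdge ns} {u} → ¬ Joined e u u
joined-irreflexive {u = u} j = contradiction (trans (sym (dist-refl u)) (joined-dist j)) λ ()

opposed : ∀ {x y a b : ℕ} → x ≡ a → y ≡ suc a → x ≡ suc b → y ≡ b → ⊥
opposed refl refl refl ()

joined-unique : ∀ {e e′ : GridEdge ns} {u v} → Joined e u v → Joined e′ u v → e ≡ e′
joined-unique (up p q)   (up p′ q′)   = cong (λ l → here l _) (toℕ-injective (trans (sym p) p′))
joined-unique (down p q) (down p′ q′) = cong (λ l → here l _) (toℕ-injective (trans (sym q) q′))
joined-unique (up p q)   (down p′ q′) = ⊥-elim (opposed p q p′ q′)
joined-unique (down p q) (up p′ q′)   = ⊥-elim (opposed q p q′ p′)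
joined-unique (along j)  (along j′)   = cong (there _) (joined-unique j j′)
joined-unique (up p q)   (along j)    = contradiction j joined-irreflexive
joined-unique (down p q) (along j)    = contradiction j joined-irreflexive
joined-unique (along j)  (up _ _)     = contradiction j joined-irreflexive
joined-unique (along j)  (down _ _)   = contradiction j joined-irreflexive

-- This gives injectivity of `toGridEdge` up to orientation, as `_≈ₑ_` demands.
joined-ends : ∀ {e : GridEdge ns} {u v u′ v′} → Joined e u v → Joined e u′ v′ →
              (u ≡ u′ × v ≡ v′) ⊎ (u ≡ v′ × v ≡ u′)
joined-ends {u = _ ∷ w} (up p q) (up p′ q′) = inj₁
  (cong (_∷ w) (toℕ-injective (trans p (sym p′))) , cong (_∷ w) (toℕ-injective (trans q (sym q′))))
joined-ends {u = _ ∷ w} (up p q) (down p′ q′) = inj₂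
  (cong (_∷ w) (toℕ-injective (trans p (sym q′))) , cong (_∷ w) (toℕ-injective (trans q (sym p′))))
joined-ends {u = _ ∷ w} (down p q) (up p′ q′) = inj₂
  (cong (_∷ w) (toℕ-injective (trans p (sym q′))) , cong (_∷ w) (toℕ-injective (trans q (sym p′))))
joined-ends {u = _ ∷ w} (down p q) (down p′ q′) = inj₁
  (cong (_∷ w) (toℕ-injective (trans p (sym p′))) , cong (_∷ w) (toℕ-injective (trans q (sym q′))))
joined-ends (along j) (along j′) with joined-ends j j′
... | inj₁ (refl , refl) = inj₁ (refl , refl)
... | inj₂ (refl , refl) = inj₂ (refl , refl)

joined-exists : (e : GridEdge ns) → ∃ λ u → ∃ λ v → Joined e u v
joined-exists {ns = suc n ∷ _} (here l u) =
  inject₁ l ∷ u , suc l ∷ u , up (toℕ-inject₁ l) refl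
joined-exists (there x e) = let u , v , j = joined-exists e in x ∷ u , x ∷ v , along j

toGridEdge : Edge (Grid ns) → GridEdge ns
toGridEdge (edge u v adj) = let i , s = dist≡1⇒step u v adj in edgeAt i u v s

toGridEdge-joined : (e : Edge (Grid ns)) → Joined (toGridEdge e) (src e) (tgt e)
toGridEdge-joined (edge u v adj) = let i , s = dist≡1⇒step u v adj in edgeAt-joined i u v s

toGridEdge-unique : ∀ {e : Edge (Grid ns)} {ge u v} → Joined ge u v → Joins (Grid ns) u v e →
  toGridEdge e ≡ ge
toGridEdge-unique {e = e} j (inj₁ (refl , refl)) = joined-unique (toGridEdge-joined e) j
toGridEdge-unique {e = e} j (inj₂ (refl , refl)) = joined-unique (toGridEdge-joined e) (joined-sym j)

edgeLabeling : ∀ {N} → GridEdge ns ↔ Fin N → EdgeLabeling (Grid ns)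
edgeLabeling {ns = ns} {N} code = record
  { size = N
  ; bijection = record
    { to        = to ∘ toGridEdge
    ; cong      = λ {e} {e′} e≈e′ → cong to (toGridEdge-unique (toGridEdge-joined e′) e≈e′)
    ; bijective =
      (λ {e} {e′} eq → joined-ends (toGridEdge-joined e)
        (subst (λ ge → Joined ge (src e′) (tgt e′)) (sym (injective eq)) (toGridEdge-joined e′))) ,
      λ k → let u , v , j = joined-exists (from k) in
        edge u v (joined-dist j) ,
        λ e≈ → trans (cong to (toGridEdge-unique j e≈)) (strictlyInverseˡ k)
    }
  }
  where
  open Inverse code using (to; from; strictlyInverseˡ; strictlyInverseʳ)
  injective : ∀ {a b} → to a ≡ to b → a ≡ b
  injective {a} {b} eq = trans (sym (strictlyInverseʳ a)) (trans (cong from eq) (strictlyInverseʳ b))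

vertexLabeling : ∀ {N} → All Fin ns ↔ Fin N → VertexLabeling (Grid ns)
vertexLabeling code = record { bijection = ↔⇒⤖ code }

involution↔ : ∀ {A : Set} (f : A → A) → (∀ x → f (f x) ≡ x) → A ↔ A
involution↔ f f² = mk↔ₛ′ f f f² f²

-- Edge labels for the planar grid.

-- The order is: the bottom row of `a` horizontal edges, then `b` blocks, each made of `suc a`
-- vertical edges and the next row of `a` horizontal ones. `opposite` reverses the vertical edges,
-- both between blocks and within a block.
planarEdge↔ : ∀ a b → GridEdge (suc a ∷ suc b ∷ []) ↔ Fin (a + b * (suc a + a))
planarEdge↔ a b = ↔-trans split
  (↔-trans (↔-refl ⊎-↔ ↔-trans (↔-refl ×-↔ ↔-sym +↔⊎) (↔-sym *↔×)) (↔-sym +↔⊎))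
  where
  split : GridEdge (suc a ∷ suc b ∷ []) ↔ (Fin a ⊎ (Fin b × (Fin (suc a) ⊎ Fin a)))
  split = mk↔ₛ′
    (λ { (here l (zero ∷ []))  → inj₁ l
       ; (here l (suc y ∷ [])) → inj₂ (y , inj₂ l)
       ; (there x (here l [])) → inj₂ (opposite l , inj₁ (opposite x)) })
    (λ { (inj₁ l)              → here l (zero ∷ [])
       ; (inj₂ (y , inj₂ l))   → here l (suc y ∷ [])
       ; (inj₂ (y , inj₁ x))   → there (opposite x) (here (opposite y) []) })
    (λ { (inj₁ l)              → refl
       ; (inj₂ (y , inj₂ l))   → refl
       ; (inj₂ (y , inj₁ x))   → cong₂ (λ y x → inj₂ (y , inj₁ x))
                                     (opposite-involutive y) (opposite-involutive x) })
    (λ { (here l (zero ∷ []))  → refl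
       ; (here l (suc y ∷ [])) → refl
       ; (there x (here l [])) → cong₂ (λ x l → there x (here l []))
                                     (opposite-involutive x) (opposite-involutive l) })

planarCode : ∀ {a b} → GridEdge (suc a ∷ suc b ∷ []) → ℕ
planarCode {a} {b} e = toℕ (Inverse.to (planarEdge↔ a b) e)

planarCode-here : ∀ {a b} l u → planarCode {a} {b} (here l u) ≡ (suc a + a) * toℕ (head u) + toℕ l
planarCode-here {a} {b} l (zero ∷ []) = trans (toℕ-↑ˡ l _) (sym (cong (_+ toℕ l) (*-zeroʳ (suc a + a))))
planarCode-here {a} {b} l (suc y ∷ []) = begin
  planarCode {a} {b} (here l (suc y ∷ [])) ≡⟨ toℕ-↑ʳ a _ ⟩
  a + toℕ (combine y (suc a ↑ʳ l)) ≡⟨ cong (a +_) (toℕ-combine y (suc a ↑ʳ l)) ⟩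
  a + ((suc a + a) * toℕ y + toℕ (suc a ↑ʳ l))
    ≡⟨ cong (λ r → a + ((suc a + a) * toℕ y + r)) (toℕ-↑ʳ (suc a) l) ⟩
  a + ((suc a + a) * toℕ y + (suc a + toℕ l)) ≡⟨ reorder a (toℕ y) (toℕ l) ⟩
  (suc a + a) * suc (toℕ y) + toℕ l ∎
  where
  reorder : ∀ a y l → a + ((suc a + a) * y + (suc a + l)) ≡ (suc a + a) * suc y + l
  reorder = solve-∀

planarCode-there : ∀ {a b} x l u → planarCode {a} {b} (there x (here l u)) ≡
  a + ((suc a + a) * toℕ (opposite l) + toℕ (opposite x))
planarCode-there {a} {b} x l [] = begin
  planarCode {a} {b} (there x (here l [])) ≡⟨ toℕ-↑ʳ a _ ⟩
  a + toℕ (combine (opposite l) (opposite x ↑ˡ a))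
    ≡⟨ cong (a +_) (toℕ-combine (opposite l) (opposite x ↑ˡ a)) ⟩
  a + ((suc a + a) * toℕ (opposite l) + toℕ (opposite x ↑ˡ a))
    ≡⟨ cong (λ r → a + ((suc a + a) * toℕ (opposite l) + r)) (toℕ-↑ˡ (opposite x) a) ⟩
  a + ((suc a + a) * toℕ (opposite l) + toℕ (opposite x)) ∎

-- Two adjacent coordinates are the lower one and its successor.
low-pair : {x y : Fin n} (adj : Adj (toℕ x) (toℕ y)) →
  toℕ x + toℕ y ≡ suc (toℕ (low x y adj) + toℕ (low x y adj))
low-pair {x = x} {y} adj rewrite toℕ-fromℕ< {m = toℕ x ⊓ toℕ y} (Adj⇒⊓<pred {x = x} {y} adj) with adj
... | inj₁ e rewrite e | m≤n⇒m⊓n≡m (n≤1+n (toℕ x)) = +-suc (toℕ x) (toℕ x)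
... | inj₂ e rewrite e | m≥n⇒m⊓n≡n (n≤1+n (toℕ y)) = refl

low-sym : {x y : Fin n} (adj : Adj (toℕ x) (toℕ y)) (adj′ : Adj (toℕ y) (toℕ x)) →
  toℕ (low y x adj′) ≡ toℕ (low x y adj)
low-sym {x = x} {y} adj adj′ = trans (toℕ-fromℕ< _) (trans (⊓-comm (toℕ y) (toℕ x)) (sym (toℕ-fromℕ< _)))

private
  coord-reorder : ∀ x y o → 1 + ((x + o) + (y + o)) ≡ 1 + ((x + y) + (o + o))
  coord-reorder = solve-∀

  coord-regroup : ∀ l o → 1 + ((1 + (l + l)) + (o + o)) ≡ ((1 + l) + o) + ((1 + l) + o)
  coord-regroup = solve-∀

  low-reorder : ∀ l o o′ → 3 + ((l + o) + (l + o′)) ≡ (1 + (l + l)) + (2 + (o + o′))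
  low-reorder = solve-∀

  low-regroup : ∀ x y o o′ → (x + y) + (2 + (o + o′)) ≡ ((1 + x) + o) + ((1 + y) + o′)
  low-regroup = solve-∀

module _ {a} {x : Fin L → Fin (suc a)} {ρ : Fin L → Fin L} (ρ² : Involutive ρ)
         (adj : ∀ p → Adj (toℕ (x p)) (toℕ (x (ρ p)))) where

  private
    l : Fin L → Fin a
    l p = low (x p) (x (ρ p)) (adj p)

    l-ρ : ∀ p → toℕ (l (ρ p)) ≡ toℕ (l p)
    l-ρ p = trans (cong toℕ (low-cong (adj (ρ p)) (Adj-sym (adj p)) refl (cong x (ρ² p))))
                  (low-sym (adj p) (Adj-sym (adj p)))

    o-ρ : ∀ p → toℕ (opposite (l (ρ p))) ≡ toℕ (opposite (l p))
    o-ρ p = cong (toℕ ∘ opposite) (toℕ-injective (l-ρ p))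

  -- The coordinate averages `l` + 1/2 over the two ends of an edge and `opposite` subtracts `l`, so
  -- the position cancels. `mean-low-coord` is the same with the roles of edge and coordinate
  -- exchanged.
  mean-coord-low : Mean (λ p → toℕ (x p) + toℕ (opposite (l p))) (pred (a + a) + pred (a + a))
  mean-coord-low = mean-pair ρ² λ p → cong pred (begin
    suc ((toℕ (x p) + toℕ (opposite (l p))) + (toℕ (x (ρ p)) + toℕ (opposite (l (ρ p)))))
      ≡⟨ cong (λ o → suc ((toℕ (x p) + toℕ (opposite (l p))) + (toℕ (x (ρ p)) + o))) (o-ρ p) ⟩
    suc ((toℕ (x p) + toℕ (opposite (l p))) + (toℕ (x (ρ p)) + toℕ (opposite (l p))))
      ≡⟨ coord-reorder (toℕ (x p)) (toℕ (x (ρ p))) (toℕ (opposite (l p))) ⟩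
    suc ((toℕ (x p) + toℕ (x (ρ p))) + (toℕ (opposite (l p)) + toℕ (opposite (l p))))
      ≡⟨ cong (λ s → suc (s + (toℕ (opposite (l p)) + toℕ (opposite (l p))))) (low-pair (adj p)) ⟩
    suc (suc (toℕ (l p) + toℕ (l p)) + (toℕ (opposite (l p)) + toℕ (opposite (l p))))
      ≡⟨ coord-regroup (toℕ (l p)) (toℕ (opposite (l p))) ⟩
    (suc (toℕ (l p)) + toℕ (opposite (l p))) + (suc (toℕ (l p)) + toℕ (opposite (l p)))
      ≡⟨ cong₂ _+_ (toℕ-opposite (l p)) (toℕ-opposite (l p)) ⟩
    a + a ∎)

  mean-low-coord : Mean (λ p → toℕ (l p) + toℕ (opposite (x p))) (pred (a + a) + pred (a + a))
  -- Of the three added units, one completes `l + l` to the sum of the two ends, and two complete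
  -- each end and its `opposite` to `suc a`.
  mean-low-coord = mean-pair ρ² λ p → cong pred (suc-injective (suc-injective (begin
    3 + ((toℕ (l p) + toℕ (opposite (x p))) + (toℕ (l (ρ p)) + toℕ (opposite (x (ρ p)))))
      ≡⟨ cong (λ m → 3 + ((toℕ (l p) + toℕ (opposite (x p))) + (m + toℕ (opposite (x (ρ p)))))) (l-ρ p) ⟩
    3 + ((toℕ (l p) + toℕ (opposite (x p))) + (toℕ (l p) + toℕ (opposite (x (ρ p)))))
      ≡⟨ low-reorder (toℕ (l p)) (toℕ (opposite (x p))) (toℕ (opposite (x (ρ p)))) ⟩
    suc (toℕ (l p) + toℕ (l p)) + (2 + (toℕ (opposite (x p)) + toℕ (opposite (x (ρ p)))))
      ≡⟨ cong (_+ (2 + (toℕ (opposite (x p)) + toℕ (opposite (x (ρ p)))))) (low-pair (adj p)) ⟨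
    (toℕ (x p) + toℕ (x (ρ p))) + (2 + (toℕ (opposite (x p)) + toℕ (opposite (x (ρ p)))))
      ≡⟨ low-regroup (toℕ (x p)) (toℕ (x (ρ p))) (toℕ (opposite (x p))) (toℕ (opposite (x (ρ p)))) ⟩
    (suc (toℕ (x p)) + toℕ (opposite (x p))) + (suc (toℕ (x (ρ p))) + toℕ (opposite (x (ρ p))))
      ≡⟨ cong₂ _+_ (toℕ-opposite (x p)) (toℕ-opposite (x (ρ p))) ⟩
    suc a + suc a
      ≡⟨ cong suc (+-suc a a) ⟩
    2 + (a + a) ∎)))

planarMean : ℕ → ℕ → ℕ
planarMean a b = (suc a + a) * (pred (b + b) + pred (b + b)) + ((pred (a + a) + pred (a + a)) + 4 * a)

-- Only the combined contribution of both directions is constant: `y` in the horizontal code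
-- balances the vertical edge's position, and `x` in the vertical code balances the horizontal
-- edge's position.
mean-planar : ∀ {a b} (C : Cube (suc a ∷ suc b ∷ []) L) →
  Mean (λ p → planarCode (cubeEdge C zero p) + planarCode (cubeEdge C (suc zero) p)) (planarMean a b)
mean-planar {a = a} {b} C = mean-cong (λ p → sym (code p))
  (mean-+ (mean-* (suc a + a) (mean-coord-low (τ² (suc zero)) (moves ∘ step (suc zero))))
          (mean-+ (mean-low-coord (τ² zero) (moves ∘ step zero)) (mean-const a)))
  where
  open Cube C
  x = λ p → head (v p)
  y = λ p → head (tail (v p))
  l₀ = λ p → low (x p) (x (τ zero p)) (moves (step zero p))
  l₁ = λ p → low (y p) (y (τ (suc zero) p)) (moves (step (suc zero) p))
  regroup : ∀ A y l a m x → (A * y + l) + (a + (A * m + x)) ≡ A * (y + m) + ((l + x) + a)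
  regroup = solve-∀
  code : ∀ p → planarCode (cubeEdge C zero p) + planarCode (cubeEdge C (suc zero) p)
    ≡ (suc a + a) * (toℕ (y p) + toℕ (opposite (l₁ p))) + ((toℕ (l₀ p) + toℕ (opposite (x p))) + a)
  code p = trans (cong₂ _+_ (planarCode-here (l₀ p) (tail (v p)))
                      (planarCode-there (x p) (l₁ p) (tail (tail (v p)))))
    (regroup (suc a + a) (toℕ (y p)) (toℕ (l₀ p)) a (toℕ (opposite (l₁ p))) (toℕ (opposite (x p))))

-- In mean-total, each edge of the cube is counted from both of its ends.
record BalancedEdges (ns : Vec ℕ d) : Set where
  field
    {N}   : ℕ
    code  : GridEdge ns ↔ Fin N
    total : ℕ
    mean-total : (C : Cube ns L) → Mean (λ p → sum (λ i → suc (toℕ (Inverse.to code (cubeEdge C i p))))) total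

balancedEdges : d ≥ 2 → {ns : Vec ℕ d} → All (_≥ 2) ns → BalancedEdges ns
balancedEdges _ {_ ∷ _ ∷ []} (s≤s {n = a} _ ∷ s≤s {n = b} _ ∷ []) = record
  { code = planarEdge↔ a b
  -- Each corner sees two edges, and each label is one more than its code.
  ; total = 4 * 2 + planarMean a b
  ; mean-total = λ C → mean-cong
      (λ p → shift (planarCode (cubeEdge C zero p)) (planarCode (cubeEdge C (suc zero) p)))
      (mean-+ (mean-const 2) (mean-planar C))
  }
  where
  shift : ∀ x y → 2 + (x + y) ≡ suc x + (suc y + 0)
  shift = solve-∀
balancedEdges _ {ns@(_ ∷ _ ∷ _ ∷ _)} _ = record
  { code = ↔-trans (involution↔ twistEdge twistEdge-involutive) (edge↔ ns)
  ; total = sum (λ i → 4 * 1 + edgeMean {ns = ns} i)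
  ; mean-total = λ C → mean-∑ (λ i → mean-+ (mean-const 1) (mean-twistEdge C i))
  }
balancedEdges (s≤s ()) {_ ∷ []} _

-- Rigidity of quadrilaterals and cubes in the grid.

Adj-irreflexive : ∀ {x y} → Adj x y → x ≢ y
Adj-irreflexive (inj₁ p) refl = contradiction p λ ()
Adj-irreflexive (inj₂ p) refl = contradiction p λ ()

Adj-common : ∀ {x y z} → Adj x y → Adj x z → ¬ Adj y z
Adj-common (inj₁ refl) (inj₁ refl) a = Adj-irreflexive a refl
Adj-common (inj₁ refl) (inj₂ refl) (inj₁ ())
Adj-common (inj₁ refl) (inj₂ refl) (inj₂ ())
Adj-common (inj₂ refl) (inj₁ refl) (inj₁ ())
Adj-common (inj₂ refl) (inj₁ refl) (inj₂ ())
Adj-common (inj₂ refl) (inj₂ refl) a = Adj-irreflexive a refl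

Adj-opposite : ∀ {x y z w} → Adj x y → Adj x z → y ≢ z → Adj y w → Adj z w → w ≡ x
Adj-opposite (inj₁ refl) (inj₁ refl) y≢z _ _ = contradiction refl y≢z
Adj-opposite (inj₂ refl) (inj₂ refl) y≢z _ _ = contradiction refl y≢z
Adj-opposite (inj₁ refl) (inj₂ refl) _ (inj₂ refl) _ = refl
Adj-opposite (inj₁ refl) (inj₂ refl) _ (inj₁ refl) (inj₁ ())
Adj-opposite (inj₁ refl) (inj₂ refl) _ (inj₁ refl) (inj₂ ())
Adj-opposite (inj₂ refl) (inj₁ refl) _ _ (inj₂ refl) = refl
Adj-opposite (inj₂ refl) (inj₁ refl) _ (inj₁ ()) (inj₁ refl)
Adj-opposite (inj₂ refl) (inj₁ refl) _ (inj₂ ()) (inj₁ refl)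

step-irreflexive : ∀ {i} {u v : All Fin ns} → Step i u v → u ≢ v
step-irreflexive {i = i} s u≡v = Adj-irreflexive (moves s) (cong (coord i) u≡v)

step-axis : ∀ {i j} {u v : All Fin ns} → Step i u v → Step j u v → i ≡ j
step-axis {i = i} {j} s t with i ≟ j
... | yes i≡j = i≡j
... | no i≢j  = contradiction (fixes t i≢j) (Adj-irreflexive (moves s))

-- The points `a` and `b` lie on either side of `u` on axis `i`. A step off this axis keeps the i-th
-- coordinate, so both steps to `w` must run along `i`: otherwise `a` and `b` would have equal or
-- adjacent i-th coordinates. The only number adjacent to both is that of `u`.
step-opposite : ∀ {i k l} {u a b w : All Fin ns} → Step i u a → Step i u b → a ≢ b →
                Step k a w → Step l b w → w ≡ u
step-opposite {i = i} {k} {l} {u} {a} {b} {w} ua ub a≢b aw bw = coord-ext same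
  where
  a≢bᵢ : coord i a ≢ coord i b
  a≢bᵢ eq = a≢b (coord-ext agree)
    where
    agree : ∀ j → coord j a ≡ coord j b
    agree j with j ≟ i
    ... | yes refl = eq
    ... | no j≢i   = trans (sym (fixes ua j≢i)) (fixes ub j≢i)

  k≡i : k ≡ i
  k≡i with k ≟ i | l ≟ i
  ... | yes e  | _      = e
  ... | no k≢i | no l≢i = contradiction (trans (fixes aw (k≢i ∘ sym)) (sym (fixes bw (l≢i ∘ sym)))) a≢bᵢ
  ... | no k≢i | yes refl =
    contradiction (subst (Adj _) (sym (fixes aw (k≢i ∘ sym))) (moves bw)) (Adj-common (moves ub) (moves ua))

  l≡i : l ≡ i
  l≡i with l ≟ i
  ... | yes e  = e
  ... | no l≢i with refl ← k≡i =
    contradiction (subst (Adj _) (sym (fixes bw (l≢i ∘ sym))) (moves aw)) (Adj-common (moves ua) (moves ub))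

  same : ∀ j → coord j w ≡ coord j u
  same j with refl ← k≡i | refl ← l≡i | j ≟ i
  ... | yes refl = Adj-opposite (moves ua) (moves ub) a≢bᵢ (moves aw) (moves bw)
  ... | no j≢i   = trans (sym (fixes aw j≢i)) (sym (fixes ua j≢i))

-- Opposite sides of a quadrilateral are parallel. If the side from `a` to `w` avoided axis `j`,
-- then `w` would agree with `u` in coordinate j; the side from `b` would have to undo the step
-- along `j`, giving `w` = `u`.
step-parallel : ∀ {i j k l} {u a b w : All Fin ns} → i ≢ j → Step i u a → Step j u b → w ≢ u →
                Step k a w → Step l b w → k ≡ j
step-parallel {i = i} {j} {k} {l} {u} {a} {b} {w} i≢j ua ub w≢u aw bw with k ≟ j
... | yes e  = e
... | no k≢j = contradiction (coord-ext same) w≢u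
  where
  wⱼ : coord j w ≡ coord j u
  wⱼ = trans (sym (fixes aw (k≢j ∘ sym))) (sym (fixes ua (i≢j ∘ sym)))

  l≡j : l ≡ j
  l≡j with l ≟ j
  ... | yes e  = e
  ... | no l≢j = contradiction (trans (sym wⱼ) (sym (fixes bw (l≢j ∘ sym)))) (Adj-irreflexive (moves ub))

  same : ∀ h → coord h w ≡ coord h u
  same h with refl ← l≡j | h ≟ j
  ... | yes refl = wⱼ
  ... | no h≢j   = trans (sym (fixes bw h≢j)) (sym (fixes ub h≢j))

-- Pigeonhole: a missed value could be punched out, leaving an injection into a smaller set.
Fin-injective⇒surjective : (f : Fin d → Fin d) → (∀ {a b} → f a ≡ f b → a ≡ b) → ∀ i → ∃ λ a → f a ≡ i
Fin-injective⇒surjective {suc d} f inj i with any? (λ a → f a ≟ i)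
... | yes a∈  = a∈
... | no  i∉  = contradiction
  (λ {a} {b} e → inj (punchOut-injective (avoid a) (avoid b) e))
  (<⇒notInjective (n<1+n d))
  where
  avoid : ∀ a → i ≢ f a
  avoid a e = i∉ (a , sym e)

-- The directions `a` of the abstract cube a priori correspond to different grid axes at different
-- vertices. The module reindexes them at each vertex by grid axis.
module CubicalFamily {d} {ns : Vec ℕ d} {L}
  (v : Fin L → All Fin ns) (v-injective : ∀ {p q} → v p ≡ v q → p ≡ q)
  (nbr : Fin d → Fin L → Fin L)
  (nbr-involutive : ∀ a → Involutive (nbr a))
  (nbr-comm : ∀ a b p → nbr a (nbr b p) ≡ nbr b (nbr a p))
  (nbr-injective : ∀ {a b} p → nbr a p ≡ nbr b p → a ≡ b)
  (nbr-dist : ∀ a p → dist (v p) (v (nbr a p)) ≡ 1)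
  where

  axis : Fin L → Fin d → Fin d
  axis p a = proj₁ (dist≡1⇒step (v p) (v (nbr a p)) (nbr-dist a p))

  axis-step : ∀ a p → Step (axis p a) (v p) (v (nbr a p))
  axis-step a p = proj₂ (dist≡1⇒step (v p) (v (nbr a p)) (nbr-dist a p))

  axis-step′ : ∀ a b p → Step (axis (nbr b p) a) (v (nbr b p)) (v (nbr b (nbr a p)))
  axis-step′ a b p =
    subst (λ q → Step (axis (nbr b p) a) (v (nbr b p)) (v q)) (nbr-comm a b p) (axis-step a (nbr b p))

  corner-distinct : ∀ {a b} p → a ≢ b → v (nbr b (nbr a p)) ≢ v p
  corner-distinct {a} p a≢b e =
    a≢b (nbr-injective (nbr a p) (trans (nbr-involutive a p) (sym (v-injective e))))

  -- Two neighbours on one axis have no common neighbour but `v p` by `step-opposite`, whereas the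
  -- fourth corner of the abstract square is such a neighbour, distinct from `v p`.
  axis-injective : ∀ p {a b} → axis p a ≡ axis p b → a ≡ b
  axis-injective p {a} {b} e with a ≟ b
  ... | yes a≡b = a≡b
  ... | no a≢b  = contradiction
    (step-opposite (axis-step a p) (subst (λ i → Step i (v p) (v (nbr b p))) (sym e) (axis-step b p))
      (a≢b ∘ nbr-injective p ∘ v-injective) (axis-step b (nbr a p)) (axis-step′ a b p))
    (corner-distinct p a≢b)

  direction : ∀ p i → ∃ λ a → axis p a ≡ i
  direction p = Fin-injective⇒surjective (axis p) (axis-injective p)

  along-axis : Fin d → Fin L → Fin L
  along-axis i p = nbr (proj₁ (direction p i)) p

  along-axis-step : ∀ i p → Step i (v p) (v (along-axis i p))
  along-axis-step i p with a , refl ← direction p i = axis-step a p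

  along-axis-unique : ∀ {i a p} → Step i (v p) (v (nbr a p)) → nbr a p ≡ along-axis i p
  along-axis-unique {i} {a} {p} s = cong (λ b → nbr b p) (axis-injective p
    (trans (step-axis (axis-step a p) s) (sym (proj₂ (direction p i)))))

  along-axis-involutive : ∀ i → Involutive (along-axis i)
  along-axis-involutive i p = trans
    (sym (along-axis-unique
      (subst (λ q → Step i (v (along-axis i p)) (v q)) (sym back) (step-sym (along-axis-step i p)))))
    back
    where
    back : nbr (proj₁ (direction p i)) (along-axis i p) ≡ p
    back = nbr-involutive _ p

  -- The direction realising axis `j` at `p` still realises it after a step along `i`, by
  -- `step-parallel`. Commutation of the `nbr` maps thereby passes to `along-axis`.
  along-axis-corner : ∀ {i j} → i ≢ j → ∀ p →
    nbr (proj₁ (direction p j)) (along-axis i p) ≡ along-axis j (along-axis i p)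
  along-axis-corner {i} {j} i≢j p = along-axis-unique
    (subst (λ k → Step k (v (along-axis i p)) (v (nbr b (along-axis i p))))
      (step-parallel i≢j (along-axis-step i p) (along-axis-step j p) (corner-distinct p a≢b)
        (axis-step b (along-axis i p)) (axis-step′ a b p))
      (axis-step b (along-axis i p)))
    where
    a = proj₁ (direction p i)
    b = proj₁ (direction p j)
    a≢b : a ≢ b
    a≢b e = i≢j (trans (sym (proj₂ (direction p i))) (trans (cong (axis p) e) (proj₂ (direction p j))))

  cube : Cube ns L
  cube = record
    { v       = v
    ; τ       = along-axis
    ; τ²      = along-axis-involutive
    ; step    = along-axis-step
    ; commute = λ {i} {j} i≢j p → cong v (trans (sym (along-axis-corner (i≢j ∘ sym) p))
        (trans (nbr-comm _ _ p) (along-axis-corner i≢j p)))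
    }

  nbr-along-axis : ∀ a p → nbr a p ≡ along-axis (axis p a) p
  nbr-along-axis a p = along-axis-unique (axis-step a p)

-- Coordinate flips of the standard cube.

flip : Fin d → All Fin (replicate d 2) → All Fin (replicate d 2)
flip zero    (x ∷ q) = opposite x ∷ q
flip (suc a) (x ∷ q) = x ∷ flip a q

flip-involutive : ∀ a (q : All Fin (replicate d 2)) → flip a (flip a q) ≡ q
flip-involutive zero    (x ∷ q) = cong (_∷ q) (opposite-involutive x)
flip-involutive (suc a) (x ∷ q) = cong (x ∷_) (flip-involutive a q)

flip-comm : ∀ a b (q : All Fin (replicate d 2)) → flip a (flip b q) ≡ flip b (flip a q)
flip-comm zero    zero    (x ∷ q) = refl
flip-comm zero    (suc b) (x ∷ q) = refl
flip-comm (suc a) zero    (x ∷ q) = refl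
flip-comm (suc a) (suc b) (x ∷ q) = cong (x ∷_) (flip-comm a b q)

flip-step : ∀ a (q : All Fin (replicate d 2)) → Step a q (flip a q)
flip-step zero    (zero     ∷ q) = step-here (inj₁ refl)
flip-step zero    (suc zero ∷ q) = step-here (inj₂ refl)
flip-step (suc a) (x ∷ q)        = step-there (flip-step a q)

step⇒flip : ∀ {a} (q r : All Fin (replicate d 2)) → Step a q r → r ≡ flip a q
step⇒flip {suc d} {zero}  (x ∷ q) (y ∷ r) s = cong₂ _∷_ (other x y (moves s)) (sym (step-tail≡ s))
  where
  other : (x y : Fin 2) → Adj (toℕ x) (toℕ y) → y ≡ opposite x
  other zero       zero       (inj₁ ())
  other zero       zero       (inj₂ ())
  other zero       (suc zero) _ = refl
  other (suc zero) zero       _ = refl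
  other (suc zero) (suc zero) (inj₁ ())
  other (suc zero) (suc zero) (inj₂ ())
step⇒flip {suc d} {suc a} (x ∷ q) (y ∷ r) s =
  cong₂ _∷_ (sym (step-head≡ s)) (step⇒flip q r (step-tail s))

-- Sums over lists and over products of finite sets.

module _ {a ℓ} (S : Setoid a ℓ) where
  open Setoid S using (Carrier; _≈_) renaming (sym to ≈-sym)

  lookup-injective : ∀ {xs : List Carrier} → UniqueSetoid.Unique S xs →
                     ∀ i j → lookup xs i ≈ lookup xs j → i ≡ j
  lookup-injective (x∉ ∷ _) zero    zero    e = refl
  lookup-injective (x∉ ∷ _) zero    (suc j) e = contradiction e (ListAll.lookup x∉ (∈-lookup j))
  lookup-injective (x∉ ∷ _) (suc i) zero    e = contradiction (≈-sym e) (ListAll.lookup x∉ (∈-lookup i))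
  lookup-injective (_  ∷ u) (suc i) (suc j) e = cong suc (lookup-injective u i j e)

listSum-lookup : ∀ {A : Set} (f : A → ℕ) xs → listSum (map f xs) ≡ sum (λ i → f (lookup xs i))
listSum-lookup f []       = refl
listSum-lookup f (x ∷ xs) = cong (f x +_) (listSum-lookup f xs)

sum-↑ : ∀ m (f : Fin (m + n) → ℕ) → sum f ≡ sum (λ i → f (i ↑ˡ n)) + sum (λ j → f (m ↑ʳ j))
sum-↑ zero    f = refl
sum-↑ (suc m) f = trans (cong (f zero +_) (sum-↑ m (f ∘ suc))) (sym (+-assoc (f zero) _ _))

sum-combine : ∀ m (f : Fin (m * n) → ℕ) → sum f ≡ sum {m} (λ i → sum (λ j → f (combine i j)))
sum-combine zero        f = refl
sum-combine {n} (suc m) f =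
  trans (sum-↑ n f) (cong (sum (λ j → f (j ↑ˡ m * n)) +_) (sum-combine m (λ k → f (n ↑ʳ k))))

sum-×-↔ : ∀ {k l m n} (π : (Fin k × Fin l) ↔ (Fin m × Fin n)) (f : Fin m → Fin n → ℕ) →
  sum (λ i → sum (λ j → uncurry f (Inverse.to π (i , j)))) ≡ sum (λ i → sum (f i))
sum-×-↔ {k} {l} {m} {n} π f = begin
  sum (λ i → sum (λ j → uncurry f (Inverse.to π (i , j))))
    ≡⟨ flatten (uncurry f ∘ Inverse.to π) ⟨
  sum (uncurry f ∘ Inverse.to π ∘ remQuot l)
    ≡⟨ sum-cong-≗ {k * l} (λ h → cong (uncurry f)
         (sym (remQuot-combine (proj₁ (Inverse.to π (remQuot l h))) _))) ⟩
  sum (uncurry f ∘ remQuot n ∘ Inverse.to π*)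
    ≡⟨ sum-permute (uncurry f ∘ remQuot n) π* ⟨
  sum (uncurry f ∘ remQuot n)
    ≡⟨ flatten (uncurry f) ⟩
  sum (λ i → sum (f i)) ∎
  where
  π* : Permutation (k * l) (m * n)
  π* = ↔-trans *↔× (↔-trans π (↔-sym *↔×))
  flatten : ∀ {k l} (g : Fin k × Fin l → ℕ) → sum (g ∘ remQuot l) ≡ sum (λ i → sum (λ j → g (i , j)))
  flatten {k} {l} g = trans (sum-combine k (g ∘ remQuot l))
    (sum-cong-≗ {k} λ i → sum-cong-≗ {l} λ j → cong g (remQuot-combine i j))

-- From a subgraph isomorphic to the standard cube to a unit cube.

module CubeSubgraph {d} {ns : Vec ℕ d} (H : Subgraph (Grid ns)) (φ : Subgraph.graph H ≅ Q d) where

  open Subgraph H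
  open _≅_ φ
  open Inverse vertices↔ using (strictlyInverseˡ; strictlyInverseʳ)

  private
    module H = Graph graph

    vertexAt : Fin (length vertices) → All Fin ns
    vertexAt = lookup vertices

    vertexAt-injective : ∀ {p q} → vertexAt p ≡ vertexAt q → p ≡ q
    vertexAt-injective = lookup-injective (vertexSetoid (Grid ns)) vertices-unique _ _

    joins-dist : ∀ {u v} (e : Edge (Grid ns)) → Joins (Grid ns) u v e → dist u v ≡ 1
    joins-dist (edge _ _ adj) (inj₁ (refl , refl)) = adj
    joins-dist (edge u v adj) (inj₂ (refl , refl)) = trans (dist-comm v u) adj

    adjacent-dist : ∀ {p q} → p H.∼ q → dist (vertexAt p) (vertexAt q) ≡ 1
    adjacent-dist p∼q = let e , j = satisfied p∼q in joins-dist e j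

    nbr : Fin d → Fin (length vertices) → Fin (length vertices)
    -- The flips of the standard cube are transported through the isomorphism.
    nbr a p = from (flip a (to p))

    nbr-adjacent : ∀ a p → p H.∼ nbr a p
    nbr-adjacent a p = Equivalence.from preserves-∼
      (trans (cong (dist (to p)) (strictlyInverseˡ (flip a (to p)))) (step⇒dist≡1 (flip-step a (to p))))

    adjacent-nbr : ∀ {p q} → p H.∼ q → ∃ λ a → q ≡ nbr a p
    adjacent-nbr {p} {q} p∼q =
      let a , s = dist≡1⇒step (to p) (to q) (Equivalence.to preserves-∼ p∼q) in
      a , trans (sym (strictlyInverseʳ q)) (cong from (step⇒flip (to p) (to q) s))

    nbr-nbr : ∀ a b p → nbr a (nbr b p) ≡ from (flip a (flip b (to p)))
    nbr-nbr a b p = cong (from ∘ flip a) (strictlyInverseˡ (flip b (to p)))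

    nbr-involutive : ∀ a p → nbr a (nbr a p) ≡ p
    nbr-involutive a p = trans (nbr-nbr a a p)
      (trans (cong from (flip-involutive a (to p))) (strictlyInverseʳ p))

    nbr-comm : ∀ a b p → nbr a (nbr b p) ≡ nbr b (nbr a p)
    nbr-comm a b p = trans (nbr-nbr a b p)
      (trans (cong from (flip-comm a b (to p))) (sym (nbr-nbr b a p)))

    nbr-injective : ∀ {a b} p → nbr a p ≡ nbr b p → a ≡ b
    nbr-injective {a} {b} p e = step-axis (flip-step a (to p))
      (subst (Step b (to p)) (sym same) (flip-step b (to p)))
      where
      same : flip a (to p) ≡ flip b (to p)
      same = trans (sym (strictlyInverseˡ _)) (trans (cong to e) (strictlyInverseˡ _))

    module F = CubicalFamily vertexAt vertexAt-injective nbr nbr-involutive nbr-comm nbr-injective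
      (λ a p → adjacent-dist (nbr-adjacent a p))

  cube : Cube ns (length vertices)
  cube = F.cube

  open Cube cube

  -- Makes the index set's size the same for all copies of the cube, so that the averages yield one
  -- common sum.
  length-vertices : length vertices ≡ vertexCount (replicate d 2)
  length-vertices = ↔⇒≡ (↔-trans vertices↔ (vertex↔ (replicate d 2)))

  sum-vertices : (f : All Fin ns → ℕ) → listSum (map f vertices) ≡ sum (f ∘ v)
  sum-vertices f = listSum-lookup f vertices

  private
    edgeEnd : Fin 2 → Fin (length edges) → All Fin ns
    edgeEnd zero       k = src (lookup edges k)
    edgeEnd (suc zero) k = tgt (lookup edges k)

    -- The edge k, oriented by b, leads from the vertex p in direction i.
    record IsDart (x : Fin (length edges) × Fin 2) (y : Fin (length vertices) × Fin d) : Set where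
      constructor mkDart
      field
        starts : edgeEnd (proj₂ x) (proj₁ x) ≡ v (proj₁ y)
        ends   : edgeEnd (opposite (proj₂ x)) (proj₁ x) ≡ v (τ (proj₂ y) (proj₁ y))

    open IsDart using (starts)

    IsDart⇒joins : ∀ {k b p i} → IsDart (k , b) (p , i) → Joins (Grid ns) (v p) (v (τ i p)) (lookup edges k)
    IsDart⇒joins {b = zero}     (mkDart e e′) = inj₁ (e , e′)
    IsDart⇒joins {b = suc zero} (mkDart e e′) = inj₂ (e′ , e)

    edgeEnd∈ : ∀ b k → ∃ λ p → edgeEnd b k ≡ v p
    edgeEnd∈ b k = Any.index u∈ , lookup-index u∈
      where
      end∈ : ∀ b → edgeEnd b k ∈ vertices
      end∈ zero       = proj₁ (ListAll.lookup ends∈vertices (∈-lookup k))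
      end∈ (suc zero) = proj₂ (ListAll.lookup ends∈vertices (∈-lookup k))
      u∈ = end∈ b

    joins-ends : ∀ b k {p q} → edgeEnd b k ≡ v p → edgeEnd (opposite b) k ≡ v q → p H.∼ q
    joins-ends zero       k e e′ = lose (∈-lookup k) (inj₁ (e , e′))
    joins-ends (suc zero) k e e′ = lose (∈-lookup k) (inj₂ (e′ , e))

    -- Both ends of a listed edge are listed vertices, adjacent in the subgraph; the isomorphism
    -- makes this adjacency a flip, whose grid axis is the required direction.
    dart : ∀ x → ∃ (IsDart x)
    dart (k , b) with p , e ← edgeEnd∈ b k | q , e′ ← edgeEnd∈ (opposite b) k
                 with a , refl ← adjacent-nbr (joins-ends b k e e′) =
      (p , F.axis p a) , mkDart e (trans e′ (cong v (F.nbr-along-axis a p)))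

    dart⁻¹ : ∀ y → ∃ λ x → IsDart x y
    dart⁻¹ (p , i) with nbr-adjacent (proj₁ (F.direction p i)) p
    ... | p∼q with lookup-index p∼q
    ...   | inj₁ (e , e′) = (Any.index p∼q , zero) , mkDart e e′
    ...   | inj₂ (e , e′) = (Any.index p∼q , suc zero) , mkDart e′ e

    dart-unique : ∀ {x y y′} → IsDart x y → IsDart x y′ → y ≡ y′
    dart-unique {_} {p , i} {p′ , i′} (mkDart e f) (mkDart e′ f′)
      with refl ← vertexAt-injective {p} {p′} (trans (sym e) e′) =
      cong (p ,_) (step-axis (step i p) (subst (Step i′ (v p)) (trans (sym f′) f) (step i′ p)))

    orientation-unique : ∀ {b b′ k p i} → IsDart (k , b) (p , i) → edgeEnd b′ k ≡ v p → b ≡ b′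
    orientation-unique {zero}     {zero}     _ _ = refl
    orientation-unique {zero}     {suc zero} {i = i} (mkDart _ t) s =
      contradiction (trans (sym s) t) (step-irreflexive (step i _))
    orientation-unique {suc zero} {zero}     {i = i} (mkDart _ t) s =
      contradiction (trans (sym s) t) (step-irreflexive (step i _))
    orientation-unique {suc zero} {suc zero} _ _ = refl

    sameEdge : ∀ {k b k′ b′ p i} → IsDart (k , b) (p , i) → IsDart (k′ , b′) (p , i) → k ≡ k′
    sameEdge {k} {k′ = k′} {p = p} {i} δ δ′ = lookup-injective E edges-unique k k′
      (Setoid.trans E {lookup edges k} {e} {lookup edges k′} (IsDart⇒joins δ)
        (Setoid.sym E {lookup edges k′} {e} (IsDart⇒joins δ′)))
      where
      E = edgeSetoid (Grid ns)
      -- Both listed edges equal this one up to orientation, and the list of edges has no repetition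
      -- up to orientation.
      e = edge (v p) (v (τ i p)) (step⇒dist≡1 (step i p))

    dart⁻¹-unique : ∀ {x x′ y} → IsDart x y → IsDart x′ y → x ≡ x′
    dart⁻¹-unique {k , _} {k′ , _} {y} δ δ′ with refl ← sameEdge δ δ′ =
      cong (k ,_) (orientation-unique δ (starts δ′))

    darts↔ : (Fin (length edges) × Fin 2) ↔ (Fin (length vertices) × Fin d)
    darts↔ = mk↔ₛ′ (proj₁ ∘ dart) (proj₁ ∘ dart⁻¹)
      (λ y → dart-unique (proj₂ (dart _)) (proj₂ (dart⁻¹ y)))
      (λ x → dart⁻¹-unique (proj₂ (dart⁻¹ _)) (proj₂ (dart x)))

  sum-edges : (f : GridEdge ns → ℕ) →
    2 * listSum (map (f ∘ toGridEdge) edges) ≡ sum (λ p → sum (λ i → f (cubeEdge cube i p)))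
  sum-edges f = begin
    2 * listSum (map (f ∘ toGridEdge) edges)
      ≡⟨ cong (2 *_) (listSum-lookup (f ∘ toGridEdge) edges) ⟩
    2 * sum (λ k → f (toGridEdge (lookup edges k)))
      ≡⟨ *-distribˡ-sum 2 (λ k → f (toGridEdge (lookup edges k))) ⟩
    sum (λ k → sum {2} (λ _ → f (toGridEdge (lookup edges k))))
      ≡⟨ sum-cong-≗ (λ k → sum-cong-≗ {2} (λ b → cong f (same k b))) ⟩
    sum (λ k → sum {2} (λ b → dartLabel (Inverse.to darts↔ (k , b))))
      ≡⟨ sum-×-↔ darts↔ (λ p i → f (cubeEdge cube i p)) ⟩
    sum (λ p → sum (λ i → f (cubeEdge cube i p))) ∎
    where
    dartLabel : Fin (length vertices) × Fin d → ℕ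
    dartLabel (p , i) = f (cubeEdge cube i p)
    same : ∀ k b → toGridEdge (lookup edges k) ≡
      cubeEdge cube (proj₂ (proj₁ (dart (k , b)))) (proj₁ (proj₁ (dart (k , b))))
    same k b = let (p , i) , δ = dart (k , b) in
      toGridEdge-unique (edgeAt-joined i (v p) (v (τ i p)) (step i p)) (IsDart⇒joins δ)

-- The magic sums.

-- Supplies the witness for the magic sum: the averages fix only a multiple of it, and the constant
-- is read off as a quotient.
quotient : ∀ m .{{_ : NonZero m}} {s t} → m * s ≡ t → s ≡ t / m
quotient m {s} refl = sym (trans (cong (_/ m) (*-comm m s)) (m*n/n≡m s m))

vertexMagic : ∀ {m n} {ns : Vec ℕ d} → ∃ (VertexMagic (Q (suc (suc d))) (Grid (m ∷ n ∷ ns)))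
vertexMagic {d} {m} {n} {ns} = vertexLabeling code , _ , λ H φ → let open CubeSubgraph H φ in
  trans (sum-vertices _) (quotient 4 (trans (Mean.quadruple-sum (mean-+ (mean-const 1) (mean-twist cube)))
    (cong (_* (4 * 1 + vertexMean (m ∷ n ∷ ns))) length-vertices)))
  where
  code : All Fin (m ∷ n ∷ ns) ↔ Fin (vertexCount (m ∷ n ∷ ns))
  code = ↔-trans (involution↔ twist twist-involutive) (vertex↔ (m ∷ n ∷ ns))

edgeMagic : {ns : Vec ℕ d} → BalancedEdges ns → ∃ (EdgeMagic (Q d) (Grid ns))
edgeMagic {d} {ns} B = edgeLabeling code , _ , λ H φ → let open CubeSubgraph H φ in
  -- 8 = 4 * 2: the factor 4 from `Mean`, the factor 2 from counting every edge at both ends.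
  quotient 8 (trans (*-assoc 4 2 (listSum (map _ (Subgraph.edges H))))
    (trans (cong (4 *_) (sum-edges (λ e → suc (toℕ (Inverse.to code e)))))
      (trans (Mean.quadruple-sum (mean-total cube)) (cong (_* total) length-vertices))))
  where open BalancedEdges B

theorem1 : (d : ℕ) → d ≥ 2 →
    (ns : Vec ℕ d) → Linked _≥_ ns → All (_≥ 2) ns →
    ∃ (VertexMagic (Q d) (Grid ns)) × ∃ (EdgeMagic (Q d) (Grid ns))
theorem1 (suc (suc d)) d≥2 (_ ∷ _ ∷ _) _ ns≥2 = vertexMagic , edgeMagic (balancedEdges d≥2 ns≥2)
theorem1 (suc zero) (s≤s ()) _ _ _
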